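{- Let $G$ be a road network with $n$ nodes and maximum node degree $\Delta$, and let $h$ and the grids $R_0,R_1,\dots,R_h$ be as in the context. Assign to every edge $e$ an independent uniformly random integer nuance $\rho(e)\in\{0,1,\dots,\tau-1\}$ and compare paths first by length and then by total nuance. If $\tau \ge 32\,h\,n^3\binom{\Delta}{2}$, then with probability at least $1-\frac1n$ the following holds: for every $i\in[0,h]$ and every $4\times4$-cell region $B$ in $R_i$, there do not exist two distinct local shortest paths in $B$ that share the same endpoints and are equally short.
   Context: A road network $G$ is a directed, connected graph of bounded degree with $n$ nodes, each located at a point in the plane, each edge $e$ having positive length $l(e)$; path length $l(P)$ is the sum of edge lengths. Grids: a $4\times4$-cell square grid $R_h$ tightly covering all nodes is recursively refined by splitting each cell into $2\times2$ cells until each cell contains at most one node; $h$ is the number of grids so obtained, and for $i\in[0,h]$, $R_i$ denotes the square grid over the same square with $2^{h+2-i}\times2^{h+2-i}$ cells. A $4\times4$-cell region of a grid is a square block of $4\times4$ consecutive cells. A path $P$ is a local path in a region $B$ if at most one of its edges (as a straight segment) intersects the boundary of $B$. Nuance: $\rho(P)=\sum_{e\in P}\rho(e)$; path $P_1$ is shorter than $P_2$ if $l(P_1)<l(P_2)$, or $l(P_1)=l(P_2)$ and $\rho(P_1)<\rho(P_2)$; two paths are equally short if they have equal length and equal nuance. A local shortest path in $B$ is a local path in $B$ not shorter-beaten (in this order) by any other local path in $B$ with the same endpoints.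
   Formalization: A local path in B is additionally required to have at least one node in B; without this, paths lying outside B also count and the claim fails for large n. Coordinates and lengths lie in any ordered field with decidable order (classically including the reals). -}

module Defs where

open import Level using (Level; _⊔_; suc)
open import Algebra.Core using (Op₁; Op₂)
open import Algebra.Bundles using (CommutativeRing)
open import Algebra.Structures using (IsCommutativeRing)
import Algebra.Definitions.RawMonoid as RawMonoidMultiples
open import Data.Nat as ℕ using (ℕ; NonZero)
open import Data.Nat.Properties using (m^n≢0)
open import Data.Integer using (+_)
open import Data.Rational as ℚ using (ℚ)
open import Data.Fin as Fin using (Fin; toℕ; finToFun)
open import Data.Fin.Properties using (_≟_)
open import Data.Fin.Subset using (Subset; _∈_; ∣_∣)
open import Data.List using (List; []; _∷_; map; foldr; allFin)
open import Data.Nat.ListAction using (sum)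
open import Data.List.Extrema.Nat using (max)
open import Data.List.Relation.Unary.Any using (Any)
open import Data.List.Relation.Unary.AllPairs using (AllPairs)
open import Data.Vec as Vec using (count; tabulate)
open import Data.Product using (Σ; ∃; _×_; _,_)
open import Data.Sum using (_⊎_)
open import Relation.Binary.Core using (Rel)
open import Relation.Binary.Structures using (IsDecTotalOrder)
import Relation.Binary.Construct.NonStrictToStrict as NonStrictToStrict
open import Relation.Binary.Construct.Closure.Equivalence using (EqClosure)
open import Relation.Binary.PropositionalEquality using (_≡_)
open import Relation.Nullary using (¬_)

-- Coordinates and edge lengths live in an arbitrary ordered field; classically
-- the real numbers are one.

record OrderedField (c ℓ₁ ℓ₂ : Level) : Set (suc (c ⊔ ℓ₁ ⊔ ℓ₂)) where
  infix  8 -_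
  infixl 7 _*_
  infixl 6 _+_
  infix  4 _≈_ _≤_
  field
    Carrier           : Set c
    _≈_               : Rel Carrier ℓ₁
    _≤_               : Rel Carrier ℓ₂
    _+_ _*_           : Op₂ Carrier
    -_                : Op₁ Carrier
    0# 1#             : Carrier
    isCommutativeRing : IsCommutativeRing _≈_ _+_ _*_ -_ 0# 1#
    0≉1               : ¬ (0# ≈ 1#)
    inverse           : ∀ x → ¬ (x ≈ 0#) → ∃ λ y → x * y ≈ 1#
    isDecTotalOrder   : IsDecTotalOrder _≈_ _≤_
    +-monoˡ-≤         : ∀ {x y} z → x ≤ y → (x + z) ≤ (y + z)
    *-nonNegative     : ∀ {x y} → 0# ≤ x → 0# ≤ y → 0# ≤ (x * y)

  commutativeRing : CommutativeRing c ℓ₁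
  commutativeRing = record { isCommutativeRing = isCommutativeRing }

  open CommutativeRing commutativeRing public using (_-_; +-rawMonoid)
  open RawMonoidMultiples +-rawMonoid public using () renaming (_×_ to _·_)
  open NonStrictToStrict _≈_ _≤_ public using (_<_)

module _ {c ℓ₁ ℓ₂ : Level} (K : OrderedField c ℓ₁ ℓ₂) where
  open OrderedField K

  Point : Set c
  Point = Carrier × Carrier

  -- Axis-parallel, given by its lower left corner.
  record Square : Set c where
    constructor square
    field
      left bottom side : Carrier

    right top : Carrier
    right = left + side
    top   = bottom + side

  open Square

  InSquare : Square → Point → Set ℓ₂
  InSquare S (x , y) =
    (left S ≤ x × x ≤ right S) × (bottom S ≤ y × y ≤ top S)

  OnBoundary : Square → Point → Set (ℓ₁ ⊔ ℓ₂)
  OnBoundary S (x , y) = InSquare S (x , y) ×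
    (x ≈ left S ⊎ x ≈ right S ⊎ y ≈ bottom S ⊎ y ≈ top S)

  OnSegment : Point → Point → Point → Set (c ⊔ ℓ₁ ⊔ ℓ₂)
  OnSegment (x₁ , y₁) (x₂ , y₂) (x , y) = ∃ λ r →
    (0# ≤ r × r ≤ 1#) ×
    (x ≈ x₁ + r * (x₂ - x₁) × y ≈ y₁ + r * (y₂ - y₁))

  -- Connectedness is connectedness of the underlying undirected graph.
  record RoadNetwork (n : ℕ) : Set (c ⊔ ℓ₁ ⊔ ℓ₂) where
    field
      m           : ℕ
      src tgt     : Fin m → Fin n
      position    : Fin n → Point
      length      : Fin m → Carrier
      length>0    : ∀ e → 0# < length e
      connected   : ∀ u v →
        EqClosure (λ a b → ∃ λ e → src e ≡ a × tgt e ≡ b) u v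

module _ {c ℓ₁ ℓ₂ : Level} {K : OrderedField c ℓ₁ ℓ₂}
         {n : ℕ} (G : RoadNetwork K n) where
  open OrderedField K
  open RoadNetwork G

  -- Number of edges incident to v, outgoing and incoming.
  degree : Fin n → ℕ
  degree v = count (_≟ v) (tabulate src) ℕ.+ count (_≟ v) (tabulate tgt)

  maxDegree : ℕ
  maxDegree = max 0 (map degree (allFin n))

  Covers : Square K → Set ℓ₂
  Covers S = ∀ v → InSquare K S (position v)

  -- δ is the side of a cell of R₀, so a cell of Rᵢ has side 2^i · δ and Rᵢ has
  -- 2^(h+2-i) cells per axis. The refinement starts at R_h, which has 4×4 cells,
  -- and stops as soon as no cell holds two nodes. The h grids it yields are
  -- R_h, …, R₁; hence 1 ≤ h, and R₀ is one refinement further.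
  record Grids (h : ℕ) : Set (c ⊔ ℓ₁ ⊔ ℓ₂) where
    field
      left bottom δ : Carrier

    cellSide : ℕ → Carrier
    cellSide i = (2 ℕ.^ i) · δ

    cellsPerAxis : ℕ → ℕ
    cellsPerAxis i = 2 ℕ.^ (h ℕ.+ 2 ℕ.∸ i)

    -- The block of k × k cells of Rᵢ whose lower left cell is (a , b).
    block : (i k a b : ℕ) → Square K
    block i k a b = square
      (left   + a · cellSide i)
      (bottom + b · cellSide i)
      (k · cellSide i)

    whole : Square K
    whole = block 0 (cellsPerAxis 0) 0 0

    Separates : ℕ → Set ℓ₂
    Separates i = ∀ a b → a ℕ.< cellsPerAxis i → b ℕ.< cellsPerAxis i →
      ∀ u v → InSquare K (block i 1 a b) (position u) →
              InSquare K (block i 1 a b) (position v) → u ≡ v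

    field
      covers  : Covers whole
      tight   : ∀ S → Covers S → Square.side whole ≤ Square.side S
      1≤h     : 1 ℕ.≤ h
      stops   : Separates 1
      refines : ∀ i → 2 ℕ.≤ i → i ℕ.≤ h → ¬ Separates i

  record Region {h : ℕ} (R : Grids h) (i : ℕ) : Set where
    field
      column row : ℕ
      column-fits : column ℕ.+ 4 ℕ.≤ Grids.cellsPerAxis R i
      row-fits    : row    ℕ.+ 4 ℕ.≤ Grids.cellsPerAxis R i

    area : Square K
    area = Grids.block R i 4 column row

  Path : Set
  Path = List (Fin m)

  IsPath : Fin n → Fin n → Path → Set
  IsPath s t []      = s ≡ t
  IsPath s t (e ∷ P) = src e ≡ s × IsPath (tgt e) t P

  nodes : Fin n → Path → List (Fin n)
  nodes s P = s ∷ map tgt P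

  pathLength : Path → Carrier
  pathLength P = foldr _+_ 0# (map length P)

  CrossesBoundary : Square K → Fin m → Set (c ⊔ ℓ₁ ⊔ ℓ₂)
  CrossesBoundary B e = ∃ λ p →
    OnSegment K (position (src e)) (position (tgt e)) p × OnBoundary K B p

  -- A path is in B only if it has a node in B: a path whose nodes all lie
  -- outside also meets the boundary in few edges, but is not local to B.
  LocalPath : Square K → Fin n → Fin n → Path → Set (c ⊔ ℓ₁ ⊔ ℓ₂)
  LocalPath B s t P =
    IsPath s t P ×
    Any (λ v → InSquare K B (position v)) (nodes s P) ×
    AllPairs (λ e f → ¬ (CrossesBoundary B e × CrossesBoundary B f)) P

  module _ {τ : ℕ} (ρ : Fin m → Fin τ) where

    nuance : Path → ℕ
    nuance P = sum (map (λ e → toℕ (ρ e)) P)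

    Shorter : Path → Path → Set (ℓ₁ ⊔ ℓ₂)
    Shorter P Q = (pathLength P < pathLength Q) ⊎
      ((pathLength P ≈ pathLength Q) × (nuance P ℕ.< nuance Q))

    EquallyShort : Path → Path → Set ℓ₁
    EquallyShort P Q = (pathLength P ≈ pathLength Q) × (nuance P ≡ nuance Q)

    LocalShortestPath : Square K → Fin n → Fin n → Path → Set (c ⊔ ℓ₁ ⊔ ℓ₂)
    LocalShortestPath B s t P =
      LocalPath B s t P × (∀ Q → LocalPath B s t Q → ¬ Shorter Q P)

-- For ρ uniform on the functions Fin m → Fin τ (independent uniform values), A
-- has probability at least p. The sample space is enumerated by
-- finToFun : Fin (τ ^ m) → Fin m → Fin τ. Since A need not be decidable, the
-- bound is witnessed by a set S of outcomes contained in A.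
ProbabilityAtLeast : ∀ {a : Level} (m τ : ℕ) .{{_ : NonZero τ}} →
                     ℚ → ((Fin m → Fin τ) → Set a) → Set a
ProbabilityAtLeast m τ p A = Σ (Subset (τ ℕ.^ m)) λ S →
  (∀ ω → ω ∈ S → A (finToFun ω)) ×
  p ℚ.≤ ℚ._/_ (+ ∣ S ∣) (τ ℕ.^ m) {{m^n≢0 τ m}}

{-# OPTIONS --safe #-}
module Submission where

-- Let t be a node of a region B. If two distinct local shortest paths to t in B
-- are equally short, they diverge at a node v, through edges e ≠ f. The rests of
-- both paths are minimal among the paths from v to t that start with e,
-- respectively f, do not return to v, and meet the boundary of B in at most one
-- edge: replacing such a rest by another one keeps the whole path local. These
-- paths use e and f at most at their start, so once all other nuances are fixed,
-- the tie occurs for at most one value of ρ(e), that is, with probability at most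
-- 1/τ. A local path has an endpoint in B, since otherwise it would enter and leave
-- B; a path with only its source in B is treated in the reversed network. A node
-- lies in at most 25h + 1 ≤ 32h regions, and there are at most n · C(Δ, 2) pairs of
-- edges that leave, or that enter, a common node, so at most 32 h n² C(Δ, 2) ties
-- are possible and the union bound applies.

open import Defs
open import Level using (_⊔_)
open import Algebra.Bundles using (CommutativeRing)
import Algebra.Properties.CommutativeSemigroup
import Algebra.Properties.Monoid.Mult
import Algebra.Properties.Ring
import Algebra.Properties.Semiring.Mult
import Algebra.Solver.Ring
open import Algebra.Solver.Ring.AlmostCommutativeRing
  using (AlmostCommutativeRing; fromCommutativeRing; _-Raw-AlmostCommutative⟶_)
open import Data.Bool using (true; false)
open import Data.Fin as Fin using (Fin; zero; suc; toℕ; finToFun; funToFin; combine; remQuot)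
open import Data.Fin.Properties as Finₚ
  using (injective⇒≤; toℕ-injective; suc-injective; funToFin-finToFin; finToFun-funToFin;
    combine-remQuot)
open import Data.Fin.Subset as Subset using (Subset; inside; outside; ∣_∣; _∩_; ∁; ⊤; ⊥)
open import Data.Fin.Subset.Properties using (x∈p∩q⁻; x∈∁p⇒x∉p; ∣⊤∣≡n; ∉⊥)
open import Data.Integer as ℤ using (ℤ; +_; -[1+_])
import Data.Integer.Properties as ℤₚ
open import Data.List as List
  using ( List; []; _∷_; _++_; zip; map; filter; length; lookup; reverse; allFin; upTo; concatMap
        ; cartesianProduct; cartesianProductWith)
open import Data.List.Extrema.Nat using (xs≤max)
open import Data.List.Membership.Propositional using (_∈_; find; lose)
open import Data.List.Membership.Propositional.Properties
  using ( ∈-filter⁺; ∈-filter⁻; ∈-allFin; ∈-++⁺ˡ; ∈-++⁺ʳ; ∈-map⁺; ∈-concatMap⁺; ∈-cartesianProduct⁺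
        ; ∈-cartesianProduct⁻; ∈-cartesianProductWith⁺; ∈-upTo⁺; ∈-∃++; ∈-lookup)
open import Data.List.Properties
  using ( ++-assoc; length-++; length-map; length-upTo; length-filter; length-tabulate; upTo-∷ʳ
        ; concatMap-++; unfold-reverse; reverse-involutive; reverse-injective)
open import Data.List.Relation.Unary.All as All using (All; []; _∷_; all?)
import Data.List.Relation.Unary.All.Properties as Allₚ
open import Data.List.Relation.Unary.AllPairs as AllPairs using (AllPairs; []; _∷_; allPairs?)
import Data.List.Relation.Unary.AllPairs.Properties as AllPairsₚ
open import Data.List.Relation.Unary.Any as Any using (Any; here; there; any?)
import Data.List.Relation.Unary.Any.Properties as Anyₚ
open import Data.List.Relation.Unary.Unique.Propositional using (Unique)
import Data.List.Relation.Unary.Unique.Propositional.Properties as Uniqueₚ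
open import Data.Maybe using (Maybe; just; nothing)
open import Data.Nat as ℕ using (ℕ; zero; suc; NonZero)
open import Data.Nat.Combinatorics using (_C_; nC1≡n; nCk+nC[k+1]≡[n+1]C[k+1])
import Data.Nat.Properties as ℕₚ
open import Data.Nat.Tactic.RingSolver using (solve-∀)
open import Data.Product using (∃; _×_; _,_; proj₁; proj₂; swap)
open import Data.Rational as ℚ using (1ℚ)
import Data.Rational.Properties as ℚₚ
import Data.Rational.Unnormalised as ℚᵘ
import Data.Rational.Unnormalised.Properties as ℚᵘₚ
open import Data.Sum using (_⊎_; inj₁; inj₂; [_,_]′)
open import Data.Vec as Vec using ([]; _∷_; count; tabulate)
open import Data.Vec.Functional using (updateAt)
open import Data.Vec.Functional.Properties using (updateAt-updates; updateAt-minimal)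
open import Data.Vec.Properties using (lookup∘tabulate; lookup⇒[]=; []=⇒lookup)
open import Function using (_∘_; const; id)
open import Relation.Binary.Construct.Closure.Equivalence as EqClosure using (EqClosure)
open import Relation.Binary.PropositionalEquality as ≡
  using (_≡_; _≢_; refl; sym; trans; cong; cong₂; subst)
import Relation.Binary.Reasoning.Setoid
open import Relation.Binary.Structures using (IsDecTotalOrder)
open import Relation.Nullary using (¬_; Dec; yes; no; does; contradiction)
open import Relation.Nullary.Decidable
  using (map′; _×-dec_; _⊎-dec_; ¬?; decidable-stable; dec-true)
open import Relation.Unary using (Pred; Decidable)

-- Affine functions over an ordered field

-- The good outcomes must form an explicit `Subset`, so every event excluded by the union bound has
-- to be decidable, although the ordered field is arbitrary. Hence boundary crossings are decided by
-- eliminating inequalities along a segment, and continuations are enumerated only up to length `n`.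
-- The probabilistic core is the argument of the isolation lemma. What obstructs it is that locality
-- is not inherited piecewise: whether a rest may cross the boundary depends on the prefix. An
-- endpoint in the region removes this dependence: if the prefix crosses, the divergence node and
-- the target are both interior, and every admissible rest between them then avoids the boundary by
-- itself. An event is thus given by a target, a region around it and a fork, without the source of
-- the path. This saves one factor `n`; the remaining third factor in the bound on `τ` pays for the
-- failure probability `1/n`.

module _ {c ℓ₁ ℓ₂} (K : OrderedField c ℓ₁ ℓ₂) where

  -- With coefficients in K the ring solver could not decide 1# - 1# ≈ 0#, hence
  -- would not cancel terms.
  module IntegerCoefficients where
    open OrderedField K
    open CommutativeRing commutativeRing using
      ( ring; semiring; setoid; +-congˡ; +-congʳ
      ; +-assoc; +-comm; +-identityˡ; +-identityʳ; -‿inverseʳ; -‿cong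
      ; zeroˡ; zeroʳ)
      renaming (refl to ≈-refl; sym to ≈-sym; trans to ≈-trans)
    open Algebra.Properties.Ring ring
    open Algebra.Properties.Semiring.Mult semiring using (×-homo-+; ×1-homo-*)
    open Relation.Binary.Reasoning.Setoid setoid

    fromℕ : ℕ → Carrier
    fromℕ k = k · 1#

    fromℤ : ℤ → Carrier
    fromℤ (+ k)    = fromℕ k
    fromℤ -[1+ k ] = - fromℕ (suc k)

    -‿homo : ∀ i → fromℤ (ℤ.- i) ≈ - fromℤ i
    -‿homo (+ zero)    = ≈-sym -0#≈0#
    -‿homo (+ (suc k)) = ≈-refl
    -‿homo -[1+ k ]    = ≈-sym (-‿involutive _)

    ⊖-homo : ∀ k l → fromℤ (k ℤ.⊖ l) ≈ fromℕ k - fromℕ l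
    ⊖-homo zero    zero    = ≈-sym (-‿inverseʳ _)
    ⊖-homo zero    (suc l) = ≈-sym (+-identityˡ _)
    ⊖-homo (suc k) zero    =
      ≈-sym (≈-trans (+-congˡ -0#≈0#) (+-identityʳ _))
    ⊖-homo (suc k) (suc l) = begin
      fromℤ (suc k ℤ.⊖ suc l)              ≡⟨ cong fromℤ (ℤₚ.[1+m]⊖[1+n]≡m⊖n k l) ⟩
      fromℤ (k ℤ.⊖ l)                      ≈⟨ ⊖-homo k l ⟩
      fromℕ k - fromℕ l                    ≈⟨ +-congʳ (+-identityˡ _) ⟨
      0# + fromℕ k - fromℕ l               ≈⟨ +-congʳ (+-congʳ (-‿inverseʳ 1#)) ⟨
      1# - 1# + fromℕ k - fromℕ l          ≈⟨ +-congʳ (+-assoc _ _ _) ⟩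
      1# + (- 1# + fromℕ k) - fromℕ l      ≈⟨ +-congʳ (+-congˡ (+-comm _ _)) ⟩
      1# + (fromℕ k - 1#) - fromℕ l        ≈⟨ +-congʳ (+-assoc _ _ _) ⟨
      1# + fromℕ k - 1# - fromℕ l          ≈⟨ +-assoc _ _ _ ⟩
      1# + fromℕ k + (- 1# - fromℕ l)      ≈⟨ +-congˡ (-‿+-comm 1# (fromℕ l)) ⟩
      (1# + fromℕ k) - (1# + fromℕ l)      ∎

    +-homo : ∀ i j → fromℤ (i ℤ.+ j) ≈ fromℤ i + fromℤ j
    +-homo (+ k)    (+ l)    = ×-homo-+ 1# k l
    +-homo (+ k)    -[1+ l ] = ⊖-homo k (suc l)
    +-homo -[1+ k ] (+ l)    = ≈-trans (⊖-homo l (suc k)) (+-comm _ _)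
    +-homo -[1+ k ] -[1+ l ] = begin
      - fromℕ (suc (suc (k ℕ.+ l)))      ≡⟨ cong (λ z → - fromℕ (suc z)) (sym (ℕₚ.+-suc k l)) ⟩
      - fromℕ (suc k ℕ.+ suc l)          ≈⟨ -‿cong (×-homo-+ 1# (suc k) (suc l)) ⟩
      - (fromℕ (suc k) + fromℕ (suc l))  ≈⟨ -‿+-comm _ _ ⟨
      - fromℕ (suc k) - fromℕ (suc l)    ∎

    *-homo : ∀ i j → fromℤ (i ℤ.* j) ≈ fromℤ i * fromℤ j
    *-homo (+ k)       (+ l)       =
      ≈-trans (reflexive′ (cong fromℤ (sym (ℤₚ.pos-* k l)))) (×1-homo-* k l)
      where
      reflexive′ : ∀ {x y} → x ≡ y → x ≈ y
      reflexive′ refl = ≈-refl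
    *-homo (+ zero)    -[1+ l ]    = ≈-sym (zeroˡ _)
    *-homo (+ (suc k)) -[1+ l ]    =
      ≈-trans (-‿cong (×1-homo-* (suc k) (suc l))) (-‿distribʳ-* _ _)
    *-homo -[1+ k ]    (+ zero)    = begin
      fromℤ (-[1+ k ] ℤ.* + 0)  ≡⟨ cong fromℤ (ℤₚ.*-zeroʳ -[1+ k ]) ⟩
      0#                        ≈⟨ zeroʳ _ ⟨
      - fromℕ (suc k) * 0#      ∎
    *-homo -[1+ k ]    (+ (suc l)) =
      ≈-trans (-‿cong (×1-homo-* (suc k) (suc l))) (-‿distribˡ-* _ _)
    *-homo -[1+ k ]    -[1+ l ]    = begin
      fromℕ (suc k ℕ.* suc l)            ≈⟨ ×1-homo-* (suc k) (suc l) ⟩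
      fromℕ (suc k) * fromℕ (suc l)      ≈⟨ -‿involutive _ ⟨
      - - (fromℕ (suc k) * fromℕ (suc l))  ≈⟨ -‿cong (-‿distribˡ-* _ _) ⟩
      - (- fromℕ (suc k) * fromℕ (suc l))  ≈⟨ -‿distribʳ-* _ _ ⟩
      - fromℕ (suc k) * - fromℕ (suc l)  ∎

    almostCommutativeRing : AlmostCommutativeRing c ℓ₁
    almostCommutativeRing = fromCommutativeRing commutativeRing

    homomorphism : ℤ.+-*-rawRing -Raw-AlmostCommutative⟶ almostCommutativeRing
    homomorphism = record
      { ⟦_⟧ = fromℤ ; +-homo = +-homo ; *-homo = *-homo ; -‿homo = -‿homo
      ; 0-homo = ≈-refl ; 1-homo = +-identityʳ 1# }

    coefficient-≟ : ∀ i j → Maybe (fromℤ i ≈ fromℤ j)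
    coefficient-≟ i j with i ℤ.≟ j
    ... | yes refl = just ≈-refl
    ... | no _       = nothing

  module Solver = Algebra.Solver.Ring
    ℤ.+-*-rawRing IntegerCoefficients.almostCommutativeRing
    IntegerCoefficients.homomorphism IntegerCoefficients.coefficient-≟
  open Solver using (solve; _:=_; _:+_; _:*_; _:-_; :-_; con)
  open OrderedField K
  open IsDecTotalOrder isDecTotalOrder using (_≤?_; total; antisym; reflexive)
    renaming (refl to ≤-refl; trans to ≤-trans)
  open CommutativeRing commutativeRing using
    ( +-congˡ; +-congʳ; *-congˡ; *-congʳ; +-comm; *-comm; +-identityˡ; +-identityʳ
    ; *-identityˡ; *-identityʳ; -‿inverseʳ; -‿cong; zeroʳ)
    renaming (refl to ≈-refl; sym to ≈-sym; trans to ≈-trans)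

  ≤-respʳ : ∀ {x y z} → y ≈ z → x ≤ y → x ≤ z
  ≤-respʳ y≈z x≤y = ≤-trans x≤y (reflexive y≈z)

  ≤-respˡ : ∀ {x y z} → x ≈ y → x ≤ z → y ≤ z
  ≤-respˡ x≈y x≤z = ≤-trans (reflexive (≈-sym x≈y)) x≤z

  ≰⇒≥ : ∀ {x y} → ¬ (x ≤ y) → y ≤ x
  ≰⇒≥ {x} {y} x≰y with total x y
  ... | inj₁ x≤y = contradiction x≤y x≰y
  ... | inj₂ y≤x = y≤x

  +-mono-≤ : ∀ {w x y z} → w ≤ x → y ≤ z → w + y ≤ x + z
  +-mono-≤ {w} {x} {y} {z} w≤x y≤z = ≤-trans (+-monoˡ-≤ y w≤x)
    (≤-respˡ (+-comm y x) (≤-respʳ (+-comm z x) (+-monoˡ-≤ x y≤z)))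

  0≤-+ : ∀ {x y} → 0# ≤ x → 0# ≤ y → 0# ≤ x + y
  0≤-+ 0≤x 0≤y = ≤-respˡ (+-identityˡ 0#) (+-mono-≤ 0≤x 0≤y)

  ≤⇒0≤- : ∀ {x y} → x ≤ y → 0# ≤ y - x
  ≤⇒0≤- {x} {y} x≤y = ≤-respˡ (-‿inverseʳ x) (+-monoˡ-≤ (- x) x≤y)

  0≤-⇒≤ : ∀ {x y} → 0# ≤ y - x → x ≤ y
  0≤-⇒≤ {x} {y} 0≤y-x = ≤-respˡ (+-identityˡ x)
    (≤-respʳ (solve 2 (λ x y → y :- x :+ x := y) ≈-refl x y) (+-monoˡ-≤ x 0≤y-x))

  +-cancelˡ-≤ : ∀ {x y} w → w + x ≤ w + y → x ≤ y
  +-cancelˡ-≤ {x} {y} w le = 0≤-⇒≤ (≤-respʳ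
    (solve 3 (λ w x y → w :+ y :- (w :+ x) := y :- x) ≈-refl w x y) (≤⇒0≤- le))

  ≤0⇒0≤- : ∀ {x} → x ≤ 0# → 0# ≤ - x
  ≤0⇒0≤- {x} x≤0 = ≤-respʳ (+-identityˡ (- x)) (≤⇒0≤- x≤0)

  0≤1 : 0# ≤ 1#
  0≤1 with total 0# 1#
  ... | inj₁ 0≤1 = 0≤1
  ... | inj₂ 1≤0 = ≤-respʳ
    (≈-trans (solve 1 (λ x → (:- x) :* (:- x) := x :* x) ≈-refl 1#) (*-identityʳ 1#))
    (*-nonNegative (≤0⇒0≤- 1≤0) (≤0⇒0≤- 1≤0))

  1≰0 : ¬ (1# ≤ 0#)
  1≰0 1≤0 = 0≉1 (antisym 0≤1 1≤0)

  x≤0⇒x*y≤0 : ∀ {x y} → x ≤ 0# → 0# ≤ y → x * y ≤ 0#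
  x≤0⇒x*y≤0 {x} {y} x≤0 0≤y = 0≤-⇒≤ (≤-respʳ
    (solve 2 (λ x y → (:- x) :* y := con (+ 0) :- x :* y) ≈-refl x y)
    (*-nonNegative (≤0⇒0≤- x≤0) 0≤y))

  inverse-nonNegative : ∀ {x y} → 0# ≤ x → x * y ≈ 1# → 0# ≤ y
  inverse-nonNegative {x} {y} 0≤x xy≈1 with 0# ≤? y
  ... | yes 0≤y = 0≤y
  ... | no 0≰y = contradiction
    (≤-respˡ (≈-trans (*-comm y x) xy≈1) (x≤0⇒x*y≤0 (≰⇒≥ 0≰y) 0≤x)) 1≰0

  -- Positivity is expressed as ¬ (x ≤ 0#).
  positive⇒≉0 : ∀ {x} → ¬ (x ≤ 0#) → ¬ (x ≈ 0#)
  positive⇒≉0 x≰0 x≈0 = x≰0 (reflexive x≈0)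

  -- An affine function on [0 , 1] is represented by its values at 0 and at 1.
  Affine : Set c
  Affine = Carrier × Carrier

  at : Carrier → Affine → Carrier
  at r (u , v) = u + r * (v - u)

  Unit : Carrier → Set ℓ₂
  Unit r = 0# ≤ r × r ≤ 1#

  at-1 : ∀ {r} f → r ≈ 1# → at r f ≈ proj₂ f
  at-1 (u , v) r≈1 = ≈-trans (+-congˡ (≈-trans (*-congʳ r≈1) (*-identityˡ _)))
    (solve 2 (λ u v → u :+ (v :- u) := v) ≈-refl u v)

  -- The right-hand side is the restriction of `f` to the parameters between `0#` and `r`,
  -- reparametrised over the unit interval. `exit` shortens its interval this way.
  at-rescale : ∀ r k f → at (r * k) f ≈ at k (proj₁ f , at r f)
  at-rescale r k (u , v) = solve 4 (λ r k u v →
    u :+ r :* k :* (v :- u) := u :+ k :* (u :+ r :* (v :- u) :- u)) ≈-refl r k u v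

  at-reverse : ∀ r u v → at (1# - r) (u , v) ≈ at r (v , u)
  at-reverse r u v = ≈-trans
    (solve 4 (λ e r u v → u :+ (e :- r) :* (v :- u) := u :+ e :* (v :- u) :+ r :* (u :- v)) ≈-refl
      1# r u v)
    (+-congʳ (≈-trans (+-congˡ (*-identityˡ _))
      (solve 2 (λ u v → u :+ (v :- u) := v) ≈-refl u v)))

  at-min : ∀ {r} f → Unit r → proj₁ f ≤ at r f ⊎ proj₂ f ≤ at r f
  at-min {r} (u , v) (0≤r , r≤1) with total u v
  ... | inj₁ u≤v = inj₁ (0≤-⇒≤ (≤-respʳ
    (solve 3 (λ r u v → r :* (v :- u) := u :+ r :* (v :- u) :- u) ≈-refl r u v)
    (*-nonNegative 0≤r (≤⇒0≤- u≤v))))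
  ... | inj₂ v≤u = inj₂ (0≤-⇒≤ (≤-respʳ
    (≈-trans (solve 4 (λ e r u v → (e :- r) :* (u :- v) := e :* (u :- v) :+ r :* (v :- u)) ≈-refl 1#
      r u v)
      (≈-trans (+-congʳ (*-identityˡ _))
        (solve 3 (λ r u v → u :- v :+ r :* (v :- u) := u :+ r :* (v :- u) :- v) ≈-refl r u v)))
    (*-nonNegative (≤⇒0≤- r≤1) (≤⇒0≤- v≤u))))

  at-nonNegative : ∀ {r} f → Unit r → 0# ≤ proj₁ f → 0# ≤ proj₂ f → 0# ≤ at r f
  at-nonNegative f r∈ 0≤u 0≤v = [ ≤-trans 0≤u , ≤-trans 0≤v ]′ (at-min f r∈)

  at-positive : ∀ {r} f → Unit r → ¬ (proj₁ f ≤ 0#) → ¬ (proj₂ f ≤ 0#) → ¬ (at r f ≤ 0#)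
  at-positive f r∈ u≰0 v≰0 at≤0 =
    [ (λ u≤ → u≰0 (≤-trans u≤ at≤0)) , (λ v≤ → v≰0 (≤-trans v≤ at≤0)) ]′ (at-min f r∈)

  Feasible : List Affine → Carrier → Carrier → Set _
  Feasible fs x y = ∃ λ r → (x ≤ r × r ≤ y) × All (λ f → 0# ≤ at r f) fs

  -- The universal property of the minimum, so that the eliminations below need no case split on
  -- which argument is smaller.
  record Meet (x y : Carrier) : Set (c ⊔ ℓ₂) where
    field
      value : Carrier
      lower : ∀ r → r ≤ value → r ≤ x × r ≤ y
      upper : ∀ r → r ≤ x → r ≤ y → r ≤ value

  meet : ∀ x y → Meet x y
  meet x y with total x y
  ... | inj₁ x≤y = record
    { value = x ; lower = λ _ r≤x → r≤x , ≤-trans r≤x x≤y ; upper = λ _ r≤x _ → r≤x }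
  ... | inj₂ y≤x = record
    { value = y ; lower = λ _ r≤y → ≤-trans r≤y y≤x , r≤y ; upper = λ _ _ r≤y → r≤y }

  -- A constraint on r is equivalent to a lower bound, to an upper bound, or to
  -- a condition free of r, so it either shrinks the interval or disappears.
  feasible? : ∀ fs x y → Dec (Feasible fs x y)
  feasible? [] x y = map′
    (λ x≤y → x , (≤-refl , x≤y) , []) (λ { (r , (x≤r , r≤y) , []) → ≤-trans x≤r r≤y }) (x ≤? y)
  feasible? ((u , v) ∷ fs) x y with v - u ≤? 0# | u - v ≤? 0#
  ... | yes d≤0 | yes e≤0 = flat (feasible? fs x y) (0# ≤? u)
    where
    d≈0 : v - u ≈ 0#
    d≈0 = antisym d≤0 (≤-respʳ (solve 2 (λ u v → :- (u :- v) := v :- u) ≈-refl u v) (≤0⇒0≤- e≤0))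
    at≈u : ∀ r → at r (u , v) ≈ u
    at≈u r = ≈-trans (+-congˡ (≈-trans (*-congˡ d≈0) (zeroʳ r))) (+-identityʳ u)
    flat : Dec (Feasible fs x y) → Dec (0# ≤ u) → Dec (Feasible ((u , v) ∷ fs) x y)
    flat (no ¬f) _ = no λ { (r , r∈ , _ ∷ ps) → ¬f (r , r∈ , ps) }
    flat (yes _) (no 0≰u) = no λ { (r , _ , p ∷ _) → 0≰u (≤-respʳ (at≈u r) p) }
    flat (yes (r , r∈ , ps)) (yes 0≤u) = yes (r , r∈ , ≤-respʳ (≈-sym (at≈u r)) 0≤u ∷ ps)
  ... | no d≰0 | _ = map′
    (λ { (r , (z≤r , r≤y) , ps) → r , (proj₁ (bounds r z≤r) , r≤y) , proj₂ (bounds r z≤r) ∷ ps })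
    (λ { (r , (x≤r , r≤y) , p ∷ ps) → r , (bounded r x≤r p , r≤y) , ps })
    (feasible? fs z y)
    where
    i = proj₁ (inverse (v - u) (positive⇒≉0 d≰0))
    di≈1 = proj₂ (inverse (v - u) (positive⇒≉0 d≰0))
    -- The slope is positive with inverse `i`, so the root is `- (u * i)`. The new lower end, the
    -- maximum of `x` and this root, is the negated minimum of their negations.
    open Meet (meet (- x) (u * i))
    z = - value
    neg : ∀ {x y} → x ≤ y → - y ≤ - x
    neg {x} {y} x≤y = 0≤-⇒≤ (≤-respʳ (solve 2 (λ x y → y :- x := (:- x) :- (:- y)) ≈-refl x y)
      (≤⇒0≤- x≤y))
    neg-neg : ∀ x → - - x ≈ x
    neg-neg x = solve 1 (λ x → :- (:- x) := x) ≈-refl x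
    collect : ∀ r → (u * i - - r) * (v - u) ≈ at r (u , v)
    collect r = ≈-trans
      (solve 4 (λ r u d i → (u :* i :- (:- r)) :* d := u :* (d :* i) :+ r :* d) ≈-refl r u (v - u) i)
      (+-congʳ (≈-trans (*-congˡ di≈1) (*-identityʳ u)))
    bounds : ∀ r → z ≤ r → x ≤ r × 0# ≤ at r (u , v)
    bounds r z≤r with lower (- r) (≤-respʳ (neg-neg _) (neg z≤r))
    ... | -r≤-x , -r≤ui = ≤-respˡ (neg-neg x) (≤-respʳ (neg-neg r) (neg -r≤-x)) ,
      ≤-respʳ (collect r) (*-nonNegative (≤⇒0≤- -r≤ui) (≰⇒≥ d≰0))
    bounded : ∀ r → x ≤ r → 0# ≤ at r (u , v) → z ≤ r
    bounded r x≤r p = ≤-respʳ (neg-neg r) (neg (upper (- r) (neg x≤r) (0≤-⇒≤ (≤-respʳ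
      (≈-trans (*-congʳ (≈-sym (collect r)))
        (≈-trans (solve 3 (λ t d i → t :* d :* i := t :* (d :* i)) ≈-refl (u * i - - r) (v - u) i)
          (≈-trans (*-congˡ di≈1) (*-identityʳ _))))
      (*-nonNegative p (inverse-nonNegative (≰⇒≥ d≰0) di≈1))))))
  ... | yes _ | no e≰0 = map′
    (λ { (r , (x≤r , r≤z) , ps) → r , (x≤r , proj₁ (bounds r r≤z)) , proj₂ (bounds r r≤z) ∷ ps })
    (λ { (r , (x≤r , r≤y) , p ∷ ps) → r , (x≤r , bounded r r≤y p) , ps })
    (feasible? fs x z)
    where
    i = proj₁ (inverse (u - v) (positive⇒≉0 e≰0))
    ei≈1 = proj₂ (inverse (u - v) (positive⇒≉0 e≰0))
    open Meet (meet y (u * i))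
    z = value
    collect : ∀ r → (u * i - r) * (u - v) ≈ at r (u , v)
    collect r = ≈-trans
      (solve 4 (λ r u v i → (u :* i :- r) :* (u :- v) := u :* ((u :- v) :* i) :+ r :* (v :- u))
        ≈-refl r u v i)
      (+-congʳ (≈-trans (*-congˡ ei≈1) (*-identityʳ u)))
    bounds : ∀ r → r ≤ z → r ≤ y × 0# ≤ at r (u , v)
    bounds r r≤z with lower r r≤z
    ... | r≤y , r≤ui = r≤y , ≤-respʳ (collect r) (*-nonNegative (≤⇒0≤- r≤ui) (≰⇒≥ e≰0))
    bounded : ∀ r → r ≤ y → 0# ≤ at r (u , v) → r ≤ z
    bounded r r≤y p = upper r r≤y (0≤-⇒≤ (≤-respʳ
      (≈-trans (*-congʳ (≈-sym (collect r)))
        (≈-trans (solve 3 (λ t d i → t :* d :* i := t :* (d :* i)) ≈-refl (u * i - r) (u - v) i)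
          (≈-trans (*-congˡ ei≈1) (*-identityʳ _))))
      (*-nonNegative p (inverse-nonNegative (≰⇒≥ e≰0) ei≈1))))

  -- With fs the signed distances to the four sides of a square along a segment,
  -- the segment meets the boundary of the square.
  Meets : List Affine → Set _
  Meets fs = ∃ λ r → Unit r × All (λ f → 0# ≤ at r f) fs × Any (λ f → at r f ≈ 0#) fs

  -- Besides `0# ≤ at r f`, the same inequality for the negated function forces a root of `f`. So
  -- each side of the square gives one system of weak inequalities, and finitely many systems
  -- remain.
  meets? : ∀ fs → Dec (Meets fs)
  meets? fs = map′ to from (any? (λ f → feasible? (negate f ∷ fs) 0# 1#) fs)
    where
    negate : Affine → Affine
    negate (u , v) = - u , - v
    at-negate : ∀ r f → at r (negate f) ≈ - at r f
    at-negate r (u , v) =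
      solve 3 (λ r u v → (:- u) :+ r :* ((:- v) :- (:- u)) := :- (u :+ r :* (v :- u))) ≈-refl r u v
    to : Any (λ f → Feasible (negate f ∷ fs) 0# 1#) fs → Meets fs
    to any with find any
    ... | f , f∈fs , r , r∈ , p ∷ ps = r , r∈ , ps , lose f∈fs
      (antisym (0≤-⇒≤ (≤-respʳ (≈-trans (at-negate r f) (≈-sym (+-identityˡ _))) p))
        (All.lookup ps f∈fs))
    from : Meets fs → Any (λ f → Feasible (negate f ∷ fs) 0# 1#) fs
    from (r , r∈ , ps , any) = Any.map
      (λ {f} at≈0 → r , r∈ , ≤-respʳ (≈-sym (at-negate r f))
        (≤0⇒0≤- (reflexive at≈0)) ∷ ps) any

  -- The largest r up to which all functions stay nonnegative: a function that is
  -- negative at the current r has a root before it.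
  exit : ∀ fs → All (λ f → 0# ≤ proj₁ f) fs →
    ∃ λ r → Unit r × All (λ f → 0# ≤ at r f) fs × (r ≈ 1# ⊎ Any (λ f → at r f ≈ 0#) fs)
  exit [] [] = 1# , (0≤1 , ≤-refl) , [] , inj₁ ≈-refl
  exit ((u , v) ∷ fs) (0≤u ∷ 0≤fs) with exit fs 0≤fs
  ... | r , r∈@(0≤r , r≤1) , ps , end with 0# ≤? at r (u , v)
  ...   | yes p = r , r∈ , p ∷ ps , [ inj₁ , (λ a → inj₂ (there a)) ]′ end
  ...   | no ≰  = r * k , rk∈ , reflexive (≈-sym at≈0) ∷ scale fs 0≤fs ps , inj₂ (here at≈0)
    where
    w = at r (u , v)
    d≰0 : ¬ (u - w ≤ 0#)
    d≰0 d≤0 = ≰ (≤-trans 0≤u (0≤-⇒≤ (≤-respʳ (solve 2 (λ u w → :- (u :- w) := w :- u) ≈-refl u w)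
      (≤0⇒0≤- d≤0))))
    i = proj₁ (inverse (u - w) (positive⇒≉0 d≰0))
    di≈1 = proj₂ (inverse (u - w) (positive⇒≉0 d≰0))
    0≤i = inverse-nonNegative (≰⇒≥ d≰0) di≈1
    -- The quotient of `u` by `u - w`: the root, in the rescaled parameter, of the function that
    -- falls from `u` to `w`.
    k = u * i
    k∈ : Unit k
    k∈ = *-nonNegative 0≤u 0≤i , 0≤-⇒≤ (≤-respʳ
      (≈-trans (solve 3 (λ u w i → (:- w) :* i := (u :- w) :* i :- u :* i) ≈-refl u w i) (+-congʳ di≈1))
      (*-nonNegative (≤0⇒0≤- (≰⇒≥ ≰)) 0≤i))
    rk∈ : Unit (r * k)
    rk∈ = *-nonNegative 0≤r (proj₁ k∈) , ≤-trans
      (0≤-⇒≤ (≤-respʳ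
        (≈-trans (solve 3 (λ e r k → (e :- r) :* k := e :* k :- r :* k) ≈-refl 1# r k)
          (+-congʳ (*-identityˡ k)))
        (*-nonNegative (≤⇒0≤- r≤1) (proj₁ k∈)))) (proj₂ k∈)
    at≈0 : at (r * k) (u , v) ≈ 0#
    at≈0 = ≈-trans (at-rescale r k (u , v)) (≈-trans
      (solve 3 (λ u i w → u :+ u :* i :* (w :- u) := u :- u :* ((u :- w) :* i)) ≈-refl u i w)
      (≈-trans (+-congˡ (-‿cong (≈-trans (*-congˡ di≈1) (*-identityʳ u)))) (-‿inverseʳ u)))
    scale : ∀ fs → All (λ f → 0# ≤ proj₁ f) fs → All (λ f → 0# ≤ at r f) fs →
      All (λ f → 0# ≤ at (r * k) f) fs
    scale [] [] [] = []
    scale (f ∷ fs) (p ∷ ps) (q ∷ qs) =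
      ≤-respʳ (≈-sym (at-rescale r k f)) (at-nonNegative (proj₁ f , at r f) k∈ p q) ∷ scale fs ps qs

  -- Either some function vanishes at the exit parameter, or that parameter is `1#`; there the
  -- function that ends nonpositive is also nonnegative, hence zero.
  leaving-meets : ∀ fs → All (λ f → 0# ≤ proj₁ f) fs → Any (λ f → proj₂ f ≤ 0#) fs → Meets fs
  leaving-meets fs 0≤fs out with exit fs 0≤fs
  ... | r , r∈ , ps , inj₂ any  = r , r∈ , ps , any
  ... | r , r∈ , ps , inj₁ r≈1 = r , r∈ , ps , at-end fs ps out
    where
    at-end : ∀ fs → All (λ f → 0# ≤ at r f) fs → Any (λ f → proj₂ f ≤ 0#) fs →
      Any (λ f → at r f ≈ 0#) fs
    at-end (f ∷ fs) (p ∷ ps) (here v≤0) = here (antisym (≤-respˡ (≈-sym (at-1 f r≈1)) v≤0) p)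
    at-end (f ∷ fs) (p ∷ ps) (there o)  = there (at-end fs ps o)

  inside-misses : ∀ fs → All (λ f → ¬ (proj₁ f ≤ 0#)) fs → All (λ f → ¬ (proj₂ f ≤ 0#)) fs → ¬ Meets fs
  inside-misses (f ∷ fs) (p ∷ _) (q ∷ _) (r , r∈ , _ , here at≈0) =
    at-positive f r∈ p q (reflexive at≈0)
  inside-misses (f ∷ fs) (_ ∷ ps) (_ ∷ qs) (r , r∈ , _ ∷ ss , there a) =
    inside-misses fs ps qs (r , r∈ , ss , a)

-- Segments and squares

module _ {c ℓ₁ ℓ₂} (K : OrderedField c ℓ₁ ℓ₂) where
  open OrderedField K
  open IsDecTotalOrder isDecTotalOrder using (_≤?_; antisym; reflexive)
  open CommutativeRing commutativeRing using
    (+-congˡ; +-congʳ; -‿cong; -‿inverseʳ)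
    renaming (refl to ≈-refl; sym to ≈-sym; trans to ≈-trans)
  open Solver K using (solve; _:=_; _:+_; _:*_; _:-_; :-_; con)

  sides : Square K → Point K → List Carrier
  sides S (x , y) =
    (x - Square.left S) ∷ (Square.right S - x) ∷ (y - Square.bottom S) ∷ (Square.top S - y) ∷ []

  InSquare⇒sides : ∀ S p → InSquare K S p → All (0# ≤_) (sides S p)
  InSquare⇒sides S p ((l , r) , b , t) = ≤⇒0≤- K l ∷ ≤⇒0≤- K r ∷ ≤⇒0≤- K b ∷ ≤⇒0≤- K t ∷ []

  sides⇒InSquare : ∀ S p → All (0# ≤_) (sides S p) → InSquare K S p
  sides⇒InSquare S p (l ∷ r ∷ b ∷ t ∷ []) = (0≤-⇒≤ K l , 0≤-⇒≤ K r) , 0≤-⇒≤ K b , 0≤-⇒≤ K t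

  inSquare? : ∀ S p → Dec (InSquare K S p)
  inSquare? S (x , y) = (_ ≤? _ ×-dec _ ≤? _) ×-dec (_ ≤? _ ×-dec _ ≤? _)

  Interior : Square K → Point K → Set _
  Interior S p = All (λ u → ¬ (u ≤ 0#)) (sides S p)

  Interior⇒InSquare : ∀ S p → Interior S p → InSquare K S p
  Interior⇒InSquare S p int = sides⇒InSquare S p (All.map (≰⇒≥ K) int)

  interpolate : Point K → Point K → Carrier → Point K
  interpolate (x₁ , y₁) (x₂ , y₂) r = x₁ + r * (x₂ - x₁) , y₁ + r * (y₂ - y₁)

  sideFunctions : Square K → Point K → Point K → List (Affine K)
  sideFunctions S p q = zip (sides S p) (sides S q)

  Crosses : Square K → Point K → Point K → Set _
  Crosses S p q = ∃ λ z → OnSegment K p q z × OnBoundary K S z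

  private
    lower : ∀ r l a b z → z ≈ a + r * (b - a) → z - l ≈ at K r (a - l , b - l)
    lower r l a b z eq = ≈-trans (+-congʳ eq)
      (solve 4 (λ r l a b → a :+ r :* (b :- a) :- l := a :- l :+ r :* (b :- l :- (a :- l))) ≈-refl r
        l a b)

    upper : ∀ r l a b z → z ≈ a + r * (b - a) → l - z ≈ at K r (l - a , l - b)
    upper r l a b z eq = ≈-trans (+-congˡ (-‿cong eq))
      (solve 4 (λ r l a b → l :- (a :+ r :* (b :- a)) := l :- a :+ r :* (l :- b :- (l :- a))) ≈-refl
        r l a b)

    ≈⇒-≈0 : ∀ {x y} → x ≈ y → x - y ≈ 0#
    ≈⇒-≈0 {x} {y} x≈y = ≈-trans (+-congʳ x≈y) (-‿inverseʳ y)

    -≈0⇒≈ : ∀ {x y} → x - y ≈ 0# → x ≈ y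
    -≈0⇒≈ {x} {y} eq = antisym
      (0≤-⇒≤ K (reflexive (≈-trans (≈-sym (≈-trans (-‿cong eq)
        (solve 0 (:- con (+ 0) := con (+ 0)) ≈-refl)))
        (solve 2 (λ x y → :- (x :- y) := y :- x) ≈-refl x y))))
      (0≤-⇒≤ K (reflexive (≈-sym eq)))

  Crosses⇒Meets : ∀ S p q → Crosses S p q → Meets K (sideFunctions S p q)
  Crosses⇒Meets S (x₁ , y₁) (x₂ , y₂) ((x , y) , (r , r∈ , x≈ , y≈) , ((l , rt) , b , t) , on) =
    r , r∈ ,
    ( ≤-respʳ K L (≤⇒0≤- K l) ∷ ≤-respʳ K R (≤⇒0≤- K rt)
    ∷ ≤-respʳ K B (≤⇒0≤- K b) ∷ ≤-respʳ K T (≤⇒0≤- K t) ∷ []) , boundary on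
    where
    L = lower r (Square.left S) x₁ x₂ x x≈
    R = upper r (Square.right S) x₁ x₂ x x≈
    B = lower r (Square.bottom S) y₁ y₂ y y≈
    T = upper r (Square.top S) y₁ y₂ y y≈
    boundary : _ → _
    boundary (inj₁ e)               = here (≈-trans (≈-sym L) (≈⇒-≈0 e))
    boundary (inj₂ (inj₁ e))        = there (here (≈-trans (≈-sym R) (≈⇒-≈0 (≈-sym e))))
    boundary (inj₂ (inj₂ (inj₁ e))) = there (there (here (≈-trans (≈-sym B) (≈⇒-≈0 e))))
    boundary (inj₂ (inj₂ (inj₂ e))) = there (there (there (here (≈-trans (≈-sym T) (≈⇒-≈0 (≈-sym e))))))

  Meets⇒Crosses : ∀ S p q → Meets K (sideFunctions S p q) → Crosses S p q
  Meets⇒Crosses S p@(x₁ , y₁) q@(x₂ , y₂) (r , r∈ , l ∷ rt ∷ b ∷ t ∷ [] , any) =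
    (x , y) , (r , r∈ , ≈-refl , ≈-refl) ,
    ((0≤-⇒≤ K (≤-respʳ K (≈-sym L) l) , 0≤-⇒≤ K (≤-respʳ K (≈-sym R) rt)) ,
      0≤-⇒≤ K (≤-respʳ K (≈-sym B) b) , 0≤-⇒≤ K (≤-respʳ K (≈-sym T) t)) ,
    boundary any
    where
    x = proj₁ (interpolate p q r)
    y = proj₂ (interpolate p q r)
    L = lower r (Square.left S) x₁ x₂ x ≈-refl
    R = upper r (Square.right S) x₁ x₂ x ≈-refl
    B = lower r (Square.bottom S) y₁ y₂ y ≈-refl
    T = upper r (Square.top S) y₁ y₂ y ≈-refl
    boundary : _ → _
    boundary (here e)                         = inj₁ (-≈0⇒≈ (≈-trans L e))
    boundary (there (here e))                 = inj₂ (inj₁ (≈-sym (-≈0⇒≈ (≈-trans R e))))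
    boundary (there (there (here e)))         = inj₂ (inj₂ (inj₁ (-≈0⇒≈ (≈-trans B e))))
    boundary (there (there (there (here e)))) = inj₂ (inj₂ (inj₂ (≈-sym (-≈0⇒≈ (≈-trans T e)))))

  -- Opaque, here and below, to keep with-abstraction from unfolding the decision.
  opaque
    crosses? : ∀ S p q → Dec (Crosses S p q)
    crosses? S p q = map′ (Meets⇒Crosses S p q) (Crosses⇒Meets S p q) (meets? K (sideFunctions S p q))

  reverse-segment : ∀ {p q z} → OnSegment K p q z → OnSegment K q p z
  reverse-segment {x₁ , y₁} {x₂ , y₂} {x , y} (r , (0≤r , r≤1) , x≈ , y≈) =
    1# - r , (≤⇒0≤- K r≤1 , 0≤-⇒≤ K (≤-respʳ K (solve 2 (λ e r → r := e :- (e :- r)) ≈-refl 1# r)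
      0≤r)) ,
    ≈-trans x≈ (≈-sym (at-reverse K r x₂ x₁)) , ≈-trans y≈ (≈-sym (at-reverse K r y₂ y₁))

  Crosses-sym : ∀ S p q → Crosses S p q → Crosses S q p
  Crosses-sym S p q (z , seg , bd) = z , reverse-segment {p} {q} {z} seg , bd

  leaving-crosses : ∀ S p q → InSquare K S p → ¬ Interior S q → Crosses S p q
  leaving-crosses S p q p∈S q∉S° = Meets⇒Crosses S p q (leaving-meets K _
    (start (InSquare⇒sides S p p∈S)) (end (Any.map (λ {u} → decidable-stable (u ≤? 0#))
      (Allₚ.¬All⇒Any¬ (λ u → ¬? (u ≤? 0#)) _ q∉S°))))
    where
    start : ∀ {a b c d a′ b′ c′ d′} → All (0# ≤_) (a ∷ b ∷ c ∷ d ∷ []) →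
      All (λ f → 0# ≤ proj₁ f) ((a , a′) ∷ (b , b′) ∷ (c , c′) ∷ (d , d′) ∷ [])
    start (a ∷ b ∷ c ∷ d ∷ []) = a ∷ b ∷ c ∷ d ∷ []
    end : ∀ {a b c d a′ b′ c′ d′} → Any (_≤ 0#) (a ∷ b ∷ c ∷ d ∷ []) →
      Any (λ f → proj₂ f ≤ 0#) ((a′ , a) ∷ (b′ , b) ∷ (c′ , c) ∷ (d′ , d) ∷ [])
    end (here a) = here a
    end (there (here a)) = there (here a)
    end (there (there (here a))) = there (there (here a))
    end (there (there (there (here a)))) = there (there (there (here a)))

  inside-uncrossed : ∀ S p q → Interior S p → Interior S q → ¬ Crosses S p q
  inside-uncrossed S p q (a ∷ b ∷ c ∷ d ∷ []) (a′ ∷ b′ ∷ c′ ∷ d′ ∷ []) cr =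
    inside-misses K _ (a ∷ b ∷ c ∷ d ∷ []) (a′ ∷ b′ ∷ c′ ∷ d′ ∷ []) (Crosses⇒Meets S p q cr)

  -- A segment ending on the boundary counts as crossing. So an uncrossed edge improves membership
  -- in the closed square to membership in the interior, and such steps chain along a path.
  uncrossed-interior : ∀ S p q → ¬ Crosses S p q → InSquare K S p → Interior S q
  uncrossed-interior S p q ¬cr p∈S = decidable-stable (all? (λ u → ¬? (u ≤? 0#)) (sides S q))
    (λ q∉ → ¬cr (leaving-crosses S p q p∈S q∉))

-- Local paths

module _ {c ℓ₁ ℓ₂} (K : OrderedField c ℓ₁ ℓ₂) {n : ℕ} (G : RoadNetwork K n) where
  open OrderedField K
  open IsDecTotalOrder isDecTotalOrder using (_≤?_; _≟_; antisym; total; reflexive)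
    renaming (refl to ≤-refl)
  open CommutativeRing commutativeRing using
    (+-congˡ; +-assoc; +-comm; +-identityˡ; +-identityʳ)
    renaming (sym to ≈-sym; trans to ≈-trans)
  open RoadNetwork G hiding (length)

  +-cancelˡ-≈ : ∀ {x y} w → w + x ≈ w + y → x ≈ y
  +-cancelˡ-≈ w eq = antisym (+-cancelˡ-≤ K w (reflexive eq)) (+-cancelˡ-≤ K w (reflexive (≈-sym eq)))

  pathLength-++ : ∀ P Q → pathLength G (P ++ Q) ≈ pathLength G P + pathLength G Q
  pathLength-++ []      Q = ≈-sym (+-identityˡ _)
  pathLength-++ (e ∷ P) Q = ≈-trans (+-congˡ (pathLength-++ P Q)) (≈-sym (+-assoc _ _ _))

  pathLength≥0 : ∀ P → 0# ≤ pathLength G P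
  pathLength≥0 []      = ≤-refl
  pathLength≥0 (e ∷ P) = 0≤-+ K (proj₁ (length>0 e)) (pathLength≥0 P)

  pathLength-∷>0 : ∀ e P → 0# < pathLength G (e ∷ P)
  pathLength-∷>0 e P = pathLength≥0 (e ∷ P) , λ eq → proj₂ (length>0 e)
    (antisym (proj₁ (length>0 e)) (≤-respʳ K (≈-sym eq)
      (≤-respˡ K (+-identityʳ _) (+-mono-≤ K ≤-refl (pathLength≥0 P)))))

  shorten : ∀ e U Q → pathLength G Q < pathLength G (e ∷ U ++ Q)
  shorten e U Q = ≤-respʳ K (≈-sym eq) (≤-respˡ K (+-identityʳ _) (+-mono-≤ K ≤-refl (proj₁ pos))) ,
    λ eq′ → proj₂ pos (+-cancelˡ-≈ (pathLength G Q) (≈-trans (+-identityʳ _) (≈-trans eq′ eq)))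
    where
    pos = pathLength-∷>0 e U
    eq : pathLength G (e ∷ U ++ Q) ≈ pathLength G Q + pathLength G (e ∷ U)
    eq = ≈-trans (pathLength-++ (e ∷ U) Q) (+-comm _ _)

  isPath? : ∀ s t P → Dec (IsPath G s t P)
  isPath? s t []      = s Finₚ.≟ t
  isPath? s t (e ∷ P) = (src e Finₚ.≟ s) ×-dec isPath? (tgt e) t P

  IsPath-split : ∀ {s t} W e X → IsPath G s t (W ++ e ∷ X) → IsPath G s (src e) W × IsPath G (tgt e) t X
  IsPath-split []      e X (refl , p) = refl , p
  IsPath-split (w ∷ W) e X (refl , p) with IsPath-split W e X p
  ... | q , r = (refl , q) , r

  IsPath-++ : ∀ {s u t} W X → IsPath G s u W → IsPath G u t X → IsPath G s t (W ++ X)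
  IsPath-++ []      X refl       q = q
  IsPath-++ (w ∷ W) X (refl , p) q = refl , IsPath-++ W X p q

  IsPath-target : ∀ {s t t′} P → IsPath G s t P → IsPath G s t′ P → t ≡ t′
  IsPath-target []      refl refl = refl
  IsPath-target (e ∷ P) (refl , p) (_ , q) = IsPath-target P p q

  target∈nodes : ∀ {s t} P → IsPath G s t P → t ∈ nodes G s P
  target∈nodes []      refl       = here refl
  target∈nodes (e ∷ P) (refl , p) = there (target∈nodes P p)

  -- Equal lengths exclude that one path is a proper prefix of the other, since the surplus edges
  -- would have positive length.
  diverge : ∀ P Q {s t} → IsPath G s t P → IsPath G s t Q → P ≢ Q → pathLength G P ≈ pathLength G Q →
    ∃ λ W → ∃ λ e → ∃ λ P′ → ∃ λ f → ∃ λ Q′ →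
      P ≡ W ++ e ∷ P′ × Q ≡ W ++ f ∷ Q′ × e ≢ f
  diverge [] [] _ _ P≢Q _ = contradiction refl P≢Q
  diverge [] (f ∷ Q) _ _ _ eq = contradiction eq (proj₂ (pathLength-∷>0 f Q))
  diverge (e ∷ P) [] _ _ _ eq = contradiction (≈-sym eq) (proj₂ (pathLength-∷>0 e P))
  diverge (e ∷ P) (f ∷ Q) (_ , p) (_ , q) P≢Q eq with e Finₚ.≟ f
  ... | no e≢f  = [] , e , P , f , Q , refl , refl , e≢f
  ... | yes refl with diverge P Q p q (P≢Q ∘ cong (e ∷_)) (+-cancelˡ-≈ _ eq)
  ...   | W , e′ , P′ , f′ , Q′ , refl , refl , e′≢f′ = e ∷ W , e′ , P′ , f′ , Q′ , refl , refl , e′≢f′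

  module _ {τ : ℕ} (ρ : Fin m → Fin τ) where

    nuance-++ : ∀ P Q → nuance G ρ (P ++ Q) ≡ nuance G ρ P ℕ.+ nuance G ρ Q
    nuance-++ []      Q = refl
    nuance-++ (e ∷ P) Q = trans (cong (toℕ (ρ e) ℕ.+_) (nuance-++ P Q))
      (sym (ℕₚ.+-assoc (toℕ (ρ e)) _ _))

    _<?_ : ∀ x y → Dec (x < y)
    x <? y = (x ≤? y) ×-dec ¬? (x ≟ y)

    shorter? : ∀ P Q → Dec (Shorter G ρ P Q)
    shorter? P Q = (_ <? _) ⊎-dec ((_ ≟ _) ×-dec (_ ℕₚ.<? _))

    Shorter-++ : ∀ W {X Y} → Shorter G ρ X Y → Shorter G ρ (W ++ X) (W ++ Y)
    Shorter-++ W {X} {Y} (inj₁ (le , ne)) = inj₁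
      ( ≤-respˡ K (≈-sym (pathLength-++ W X)) (≤-respʳ K (≈-sym (pathLength-++ W Y))
        (+-mono-≤ K ≤-refl le))
      , λ eq → ne (+-cancelˡ-≈ _ (≈-trans (≈-sym (pathLength-++ W X))
        (≈-trans eq (pathLength-++ W Y)))))
    Shorter-++ W {X} {Y} (inj₂ (eq , lt)) = inj₂
      ( ≈-trans (pathLength-++ W X) (≈-trans (+-congˡ eq) (≈-sym (pathLength-++ W Y)))
      , ≡.subst₂ ℕ._<_ (sym (nuance-++ W X)) (sym (nuance-++ W Y)) (ℕₚ.+-monoʳ-< _ lt))

    equally-minimal : ∀ P Q → ¬ Shorter G ρ P Q → ¬ Shorter G ρ Q P →
      nuance G ρ P ≡ nuance G ρ Q
    equally-minimal P Q ¬P<Q ¬Q<P with pathLength G P ≟ pathLength G Q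
    ... | no P≉Q = contradiction
      (total (pathLength G P) (pathLength G Q))
      [ (λ le → ¬P<Q (inj₁ (le , P≉Q))) , (λ le → ¬Q<P (inj₁ (le , P≉Q ∘ ≈-sym))) ]′
    ... | yes P≈Q = ℕₚ.≤-antisym (ℕₚ.≮⇒≥ (λ lt → ¬Q<P (inj₂ (≈-sym P≈Q , lt))))
      (ℕₚ.≮⇒≥ (λ lt → ¬P<Q (inj₂ (P≈Q , lt))))

  module _ (B : Square K) where

    Inside : Fin n → Set _
    Inside v = InSquare K B (position v)

    inside? : ∀ v → Dec (Inside v)
    inside? v = inSquare? K B (position v)

    NotBoth : Fin m → Fin m → Set _
    NotBoth e f = ¬ (CrossesBoundary G B e × CrossesBoundary G B f)

    cross? : ∀ e → Dec (CrossesBoundary G B e)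
    cross? e = crosses? K B (position (src e)) (position (tgt e))

    enter-interior : ∀ e → ¬ CrossesBoundary G B e → Inside (tgt e) → Interior K B (position (src e))
    enter-interior e ¬cr = uncrossed-interior K B (position (tgt e)) (position (src e))
      (¬cr ∘ Crosses-sym K B (position (tgt e)) (position (src e)))

    leave-interior : ∀ e → ¬ CrossesBoundary G B e → Inside (src e) → Interior K B (position (tgt e))
    leave-interior e = uncrossed-interior K B (position (src e)) (position (tgt e))

    exiting-path : ∀ {s t} P → IsPath G s t P → Inside s → ¬ Inside t → Any (CrossesBoundary G B) P
    exiting-path []      refl       s∈ t∉ = contradiction s∈ t∉
    exiting-path (e ∷ P) (refl , p) s∈ t∉ with cross? e
    ... | yes cr = here cr
    ... | no ¬cr = there (exiting-path P p
      (Interior⇒InSquare K B (position (tgt e)) (leave-interior e ¬cr s∈)) t∉)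

    entering-crosses : ∀ e → ¬ Inside (src e) → Inside (tgt e) → CrossesBoundary G B e
    entering-crosses e s∉ t∈ = decidable-stable (cross? e)
      (λ ¬cr → s∉ (Interior⇒InSquare K B (position (src e)) (enter-interior e ¬cr t∈)))

    endpoint-inside : ∀ {s t} P → LocalPath G B s t P → Inside s ⊎ Inside t
    endpoint-inside {s} {t} P (p , visits , local) with inside? s | inside? t
    ... | yes s∈ | _      = inj₁ s∈
    ... | no _   | yes t∈ = inj₂ t∈
    ... | no s∉  | no t∉  = contradiction (visits , local) (λ (v , l) → impossible P p s∉ v l)
      where
      impossible : ∀ {s} P → IsPath G s t P → ¬ Inside s → Any Inside (nodes G s P) →
        ¬ AllPairs NotBoth P
      impossible P       p          s∉ (here s∈) _ = s∉ s∈
      impossible (e ∷ P) (refl , p) s∉ (there v) (ne ∷ nes) with inside? (tgt e)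
      ... | no ∉   = impossible P p ∉ v nes
      ... | yes ∈B = contradiction (exiting-path P p ∈B t∉)
        (Allₚ.All¬⇒¬Any (All.map (λ ¬both cr → ¬both (entering-crosses e s∉ ∈B , cr)) ne))

    Uncrossed : List (Fin m) → Set _
    Uncrossed = All (λ e → ¬ CrossesBoundary G B e)

    -- The path has to be nonempty: its last edge turns the closed square at `t` into the interior
    -- at its own source, whereas an empty path could sit on the boundary.
    uncrossed-source : ∀ {s t} e P → IsPath G s t (e ∷ P) → Inside t → Uncrossed (e ∷ P) →
      Interior K B (position s)
    uncrossed-source e []      (refl , refl) t∈ (¬e ∷ []) = enter-interior e ¬e t∈
    uncrossed-source e (f ∷ P) (refl , p) t∈ (¬e ∷ ¬P) = enter-interior e ¬e
      (Interior⇒InSquare K B (position (tgt e)) (uncrossed-source f P p t∈ ¬P))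

    uncrossed-target : ∀ {s t} e P → IsPath G s t (e ∷ P) → Inside s → Uncrossed (e ∷ P) →
      Interior K B (position t)
    uncrossed-target e []      (refl , refl) s∈ (¬e ∷ []) = leave-interior e ¬e s∈
    uncrossed-target e (f ∷ P) (refl , p) s∈ (¬e ∷ ¬P) =
      uncrossed-target f P p (Interior⇒InSquare K B (position (tgt e)) (leave-interior e ¬e s∈)) ¬P

    -- Leaving and reentering the square takes two crossings.
    interior-ends-uncrossed : ∀ {s t} P → IsPath G s t P → AllPairs NotBoth P →
      Interior K B (position s) → Interior K B (position t) → Uncrossed P
    interior-ends-uncrossed []      _ _ _ _ = []
    interior-ends-uncrossed {s} {t} (e ∷ P) (refl , p) (ne ∷ nes) s° t° with cross? e
    ... | no ¬e = ¬e ∷ interior-ends-uncrossed P p nes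
      (leave-interior e ¬e (Interior⇒InSquare K B (position s) s°)) t°
    -- As `e` crosses, no later edge does. Going back from `t` then puts the target of `e` in the
    -- interior, and by convexity an edge between interior points does not cross.
    ... | yes cr = contradiction cr (inside-uncrossed K B (position s) (position (tgt e)) s°
      (tgt° P p ¬P))
      where
      ¬P : Uncrossed P
      ¬P = All.map (λ ¬both c → ¬both (cr , c)) ne
      tgt° : ∀ P → IsPath G (tgt e) t P → Uncrossed P → Interior K B (position (tgt e))
      tgt° []      refl _   = t°
      tgt° (f ∷ P) p    ¬P  = uncrossed-source f P p (Interior⇒InSquare K B (position t) t°) ¬P

    -- W ++ X inherits locality from W ++ e ∷ Y, whose last node lies in B: if W
    -- crosses the boundary, then e ∷ Y does not, so both ends of X are interior
    -- and X does not cross it either.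
    replace-suffix : ∀ {s t} W e Y X → LocalPath G B s t (W ++ e ∷ Y) → Inside t →
      IsPath G (src e) t X → AllPairs NotBoth X → LocalPath G B s t (W ++ X)
    replace-suffix {s} {t} W e Y X (p , _ , local) t∈ x nx =
      path , lose (target∈nodes (W ++ X) path) t∈ ,
      AllPairsₚ.++⁺ (prefix W local) nx (cross-pairs (any? cross? W))
      where
      path : IsPath G s t (W ++ X)
      path = IsPath-++ W X (proj₁ (IsPath-split W e Y p)) x
      prefix : ∀ W {V} → AllPairs NotBoth (W ++ V) → AllPairs NotBoth W
      prefix []      _          = []
      prefix (w ∷ W) (a ∷ as) = Allₚ.++⁻ˡ W a ∷ prefix W as
      after : ∀ W {V} → AllPairs NotBoth (W ++ V) → Any (CrossesBoundary G B) W → Uncrossed V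
      after (w ∷ W) (a ∷ as) (here cr) = All.map (λ ¬both c → ¬both (cr , c)) (Allₚ.++⁻ʳ W a)
      after (w ∷ W) (a ∷ as) (there w∈) = after W as w∈
      cross-pairs : Dec (Any (CrossesBoundary G B) W) → All (λ w → All (NotBoth w) X) W
      cross-pairs (no ¬W) = All.map (λ ¬w → All.universal (λ _ → ¬w ∘ proj₁) X) (Allₚ.¬Any⇒All¬ W ¬W)
      cross-pairs (yes W∋) = All.universal (λ _ → All.map (λ ¬x → ¬x ∘ proj₂) ¬X) W
        where
        ¬eY = after W local W∋
        eY : IsPath G (src e) t (e ∷ Y)
        eY = refl , proj₂ (IsPath-split W e Y p)
        v° : Interior K B (position (src e))
        v° = uncrossed-source e Y eY t∈ ¬eY
        ¬X : Uncrossed X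
        ¬X = interior-ends-uncrossed X x nx v°
          (uncrossed-target e Y eY (Interior⇒InSquare K B (position (src e)) v°) ¬eY)

-- Ties

listsUpTo : ∀ {a} {A : Set a} → List A → ℕ → List (List A)
listsUpTo xs zero    = [] ∷ []
listsUpTo xs (suc k) = [] ∷ cartesianProductWith _∷_ xs (listsUpTo xs k)

∈-listsUpTo : ∀ {a} {A : Set a} {xs : List A} → (∀ x → x ∈ xs) →
  ∀ k ys → length ys ℕ.≤ k → ys ∈ listsUpTo xs k
∈-listsUpTo all zero    []       _          = here refl
∈-listsUpTo all (suc k) []       _          = here refl
∈-listsUpTo all (suc k) (y ∷ ys) (ℕ.s≤s le) =
  there (∈-cartesianProductWith⁺ _∷_ (all y) (∈-listsUpTo all k ys le))

Unique⇒lookup-injective : ∀ {a} {A : Set a} {xs : List A} → Unique xs →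
  ∀ {i j} → lookup xs i ≡ lookup xs j → i ≡ j
Unique⇒lookup-injective (_ ∷ u)  {zero}  {zero}  _  = refl
Unique⇒lookup-injective (x∉ ∷ u) {zero}  {suc j} eq = contradiction eq (All.lookup x∉ (∈-lookup j))
Unique⇒lookup-injective (x∉ ∷ u) {suc i} {zero}  eq =
  contradiction (sym eq) (All.lookup x∉ (∈-lookup i))
Unique⇒lookup-injective (_ ∷ u)  {suc i} {suc j} eq = cong suc (Unique⇒lookup-injective u eq)

Unique⇒length≤ : ∀ {n} {xs : List (Fin n)} → Unique xs → length xs ℕ.≤ n
Unique⇒length≤ {n} u = injective⇒≤ {n = n} (Unique⇒lookup-injective u)

module _ {c ℓ₁ ℓ₂} (K : OrderedField c ℓ₁ ℓ₂) {n : ℕ} (G : RoadNetwork K n) where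
  open RoadNetwork G hiding (length)

  module _ (B : Square K) (t : Fin n) where

    NoReturn : Fin m → Path G → Set
    NoReturn e = All (λ f → src f ≢ src e)

    -- The conditions mention `e` and `t` but no prefix and no start node, so one tie event serves
    -- all sources of paths at once.
    Continuation : Fin m → Path G → Set _
    Continuation e X = IsPath G (tgt e) t X × AllPairs (NotBoth K G B) (e ∷ X) × NoReturn e X

    continuation? : ∀ e X → Dec (Continuation e X)
    continuation? e X = isPath? K G (tgt e) t X ×-dec
      (allPairs? (λ e f → ¬? (cross? K G B e ×-dec cross? K G B f)) (e ∷ X) ×-dec
      all? (λ f → ¬? (src f Finₚ.≟ src e)) X)

    opaque
      -- A finite list makes minimality and ties decidable. The cut-off at `n` loses no local
      -- shortest path that ends in the region, by `shortest-length`.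
      continuations : Fin m → List (Path G)
      continuations e = filter (continuation? e) (listsUpTo (allFin m) n)

      ∈-continuations⁺ : ∀ {e X} → Continuation e X → length X ℕ.≤ n → X ∈ continuations e
      ∈-continuations⁺ {e} cont le = ∈-filter⁺ (continuation? e) (∈-listsUpTo ∈-allFin n _ le) cont

      ∈-continuations⁻ : ∀ {e X} → X ∈ continuations e → Continuation e X
      ∈-continuations⁻ {e} X∈ = proj₂ (∈-filter⁻ (continuation? e) {xs = listsUpTo (allFin m) n} X∈)

    module _ {τ : ℕ} (ρ : Fin m → Fin τ) where

      Minimal : Fin m → Path G → Set _
      Minimal e X = All (λ Y → ¬ Shorter G ρ Y X) (continuations e)

      -- Equality of lengths is not demanded. This only enlarges the event, and the equation between
      -- nuances alone already determines the nuance of `e`.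
      Tie : Fin m → Fin m → Set _
      Tie e f = Any (λ X → Minimal e X × Any (λ Y → Minimal f Y ×
        nuance G ρ (e ∷ X) ≡ nuance G ρ (f ∷ Y)) (continuations f)) (continuations e)

      opaque
        tie? : ∀ e f → Dec (Tie e f)
        tie? e f = any? (λ X → minimal? e X ×-dec
          any? (λ Y → minimal? f Y ×-dec (_ ℕₚ.≟ _)) (continuations f)) (continuations e)
          where
          minimal? : ∀ e X → Dec (Minimal e X)
          minimal? e X = all? (λ Y → ¬? (shorter? K G ρ Y X)) (continuations e)

      -- Makes the equation in a tie independent of which minimal continuations witness it.
      minimal-nuance : ∀ e {X Y} → X ∈ continuations e → Y ∈ continuations e →
        Minimal e X → Minimal e Y → nuance G ρ X ≡ nuance G ρ Y
      minimal-nuance e {X} {Y} X∈ Y∈ Xmin Ymin =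
        equally-minimal K G ρ X Y (All.lookup Ymin X∈) (All.lookup Xmin Y∈)

      tie-sym : ∀ {e f} → Tie e f → Tie f e
      tie-sym tie with find tie
      ... | X , X∈ , Xmin , Y-tie with find Y-tie
      ... | Y , Y∈ , Ymin , eq = lose Y∈ (Ymin , lose X∈ (Xmin , sym eq))

    nuance-local : ∀ {τ} (ρ ρ′ : Fin m → Fin τ) e → (∀ f → f ≢ e → ρ f ≡ ρ′ f) →
      ∀ X → All (λ f → src f ≢ src e) X → nuance G ρ X ≡ nuance G ρ′ X
    nuance-local ρ ρ′ e agree []      []       = refl
    nuance-local ρ ρ′ e agree (f ∷ X) (ne ∷ a) =
      cong₂ ℕ._+_ (cong toℕ (agree f (ne ∘ cong src))) (nuance-local ρ ρ′ e agree X a)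

    -- All continuations avoid e, so minimality does not depend on ρ e, and the
    -- tie determines ρ e from the other nuances.
    tie-determines-nuance : ∀ {τ} (ρ ρ′ : Fin m → Fin τ) e f → e ≢ f → src e ≡ src f →
      (∀ g → g ≢ e → ρ g ≡ ρ′ g) → Tie ρ e f → Tie ρ′ e f → ρ e ≡ ρ′ e
    tie-determines-nuance ρ ρ′ e f e≢f same agree tie tie′ with find tie | find tie′
    ... | X , X∈ , Xmin , Y-tie | X′ , X′∈ , X′min , Y′-tie with find Y-tie | find Y′-tie
    ... | Y , Y∈ , Ymin , eq | Y′ , Y′∈ , Y′min , eq′ =
      toℕ-injective (ℕₚ.+-cancelʳ-≡ (nuance G ρ X) _ _ (begin
        toℕ (ρ e) ℕ.+ nuance G ρ X    ≡⟨ eq ⟩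
        toℕ (ρ f) ℕ.+ nuance G ρ Y    ≡⟨ cong₂ ℕ._+_ (cong toℕ (agree f (e≢f ∘ sym))) nuance-Y ⟩
        toℕ (ρ′ f) ℕ.+ nuance G ρ′ Y′ ≡⟨ eq′ ⟨
        toℕ (ρ′ e) ℕ.+ nuance G ρ′ X′ ≡⟨ cong (toℕ (ρ′ e) ℕ.+_) nuance-X ⟨
        toℕ (ρ′ e) ℕ.+ nuance G ρ X   ∎))
      where
      open ≡.≡-Reasoning
      -- Here the fork matters: a continuation of `f` does not return to the source of `f`, which is
      -- also that of `e`, so it cannot contain `e` either.
      avoids : ∀ g → src e ≡ src g → ∀ {Z} → Z ∈ continuations g → All (λ f → src f ≢ src e) Z
      avoids g eq Z∈ = All.map (λ ne eq′ → ne (trans eq′ eq))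
        (proj₂ (proj₂ (∈-continuations⁻ Z∈)))
      unchanged : ∀ g → src e ≡ src g → ∀ {Z} → Z ∈ continuations g → nuance G ρ′ Z ≡ nuance G ρ Z
      unchanged g eq Z∈ = sym (nuance-local ρ ρ′ e agree _ (avoids g eq Z∈))
      minimal-unchanged : ∀ g → src e ≡ src g → ∀ {Z} → Z ∈ continuations g → Minimal ρ′ g Z →
        Minimal ρ g Z
      minimal-unchanged g eq {Z} Z∈ min = All.tabulate λ
        { Y∈ (inj₁ lt) → All.lookup min Y∈ (inj₁ lt)
        ; Y∈ (inj₂ (same-length , lt)) → All.lookup min Y∈ (inj₂ (same-length ,
            ≡.subst₂ ℕ._<_ (sym (unchanged g eq Y∈)) (sym (unchanged g eq Z∈)) lt)) }
      nuance-X : nuance G ρ X ≡ nuance G ρ′ X′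
      nuance-X = trans (minimal-nuance ρ e X∈ X′∈ Xmin (minimal-unchanged e refl X′∈ X′min))
        (sym (unchanged e refl X′∈))
      nuance-Y : nuance G ρ Y ≡ nuance G ρ′ Y′
      nuance-Y = trans (minimal-nuance ρ f Y∈ Y′∈ Ymin (minimal-unchanged f same Y′∈ Y′min))
        (sym (unchanged f same Y′∈))

    drop-prefix : ∀ W {V} → AllPairs (NotBoth K G B) (W ++ V) → AllPairs (NotBoth K G B) V
    drop-prefix []      a       = a
    drop-prefix (w ∷ W) (_ ∷ a) = drop-prefix W a

    module _ {τ : ℕ} (ρ : Fin m → Fin τ) {s : Fin n} (t∈ : Inside K G B t) where

      -- A return to the source of `e` closes a loop. Cutting it out leaves a path that is still
      -- local, by `replace-suffix`, and strictly shorter, because edge lengths are positive.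
      shortest-noReturn : ∀ W e X → LocalShortestPath G ρ B s t (W ++ e ∷ X) → NoReturn e X
      shortest-noReturn W e X (local , shortest) = Allₚ.¬Any⇒All¬ X no-return
        where
        no-return : ¬ Any (λ f → src f ≡ src e) X
        no-return returns with find returns
        ... | f , f∈X , back with ∈-∃++ f∈X
        ... | U , V , refl = shortest (W ++ f ∷ V)
          (replace-suffix K G B W e X (f ∷ V) local t∈
            (back , proj₂ (IsPath-split K G U f V (proj₂ (IsPath-split K G W e X (proj₁ local)))))
            (drop-prefix (e ∷ U) (drop-prefix W (proj₂ (proj₂ local)))))
          (Shorter-++ K G ρ W (inj₁ (shorten K G e U (f ∷ V))))

      -- The absence of returns at every split makes the sources of the edges pairwise distinct, and
      -- there are only `n` nodes.
      shortest-length : ∀ P → LocalShortestPath G ρ B s t P → length P ℕ.≤ n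
      shortest-length P sp = subst (ℕ._≤ n) (length-map src P)
        (Unique⇒length≤ (AllPairsₚ.map⁺ (distinct [] P sp)))
        where
        distinct : ∀ W X → LocalShortestPath G ρ B s t (W ++ X) → AllPairs (λ e f → src e ≢ src f) X
        distinct W []      _  = []
        distinct W (e ∷ X) sp = All.map (_∘ sym) (shortest-noReturn W e X sp) ∷
          distinct (W ++ e ∷ []) X (subst (LocalShortestPath G ρ B s t)
            (sym (++-assoc W (e ∷ []) X)) sp)

      suffix-continuation : ∀ W e X → LocalShortestPath G ρ B s t (W ++ e ∷ X) → X ∈ continuations e
      suffix-continuation W e X sp@((p , _ , local) , _) = ∈-continuations⁺
        (proj₂ (IsPath-split K G W e X p) , drop-prefix W local , shortest-noReturn W e X sp)
        (ℕₚ.≤-trans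
          (ℕₚ.≤-trans (ℕₚ.n≤1+n _) (subst (suc (length X) ℕ.≤_) (sym (length-++ W))
            (ℕₚ.m≤n+m _ (length W))))
          (shortest-length (W ++ e ∷ X) sp))

      suffix-minimal : ∀ W e X → LocalShortestPath G ρ B s t (W ++ e ∷ X) → Minimal ρ e X
      suffix-minimal W e X (local , shortest) = All.tabulate λ {Y} Y∈ lt →
        let (y , ny , _) = ∈-continuations⁻ Y∈ in
        shortest (W ++ e ∷ Y) (replace-suffix K G B W e X (e ∷ Y) local t∈ (refl , y) ny)
          (Shorter-++ K G ρ W (Shorter-++ K G ρ (e ∷ []) {Y} {X} lt))

      equally-short⇒tie : ∀ P Q → P ≢ Q → LocalShortestPath G ρ B s t P →
        LocalShortestPath G ρ B s t Q →
        EquallyShort G ρ P Q → ∃ λ e → ∃ λ f → e ≢ f × src e ≡ src f × Tie ρ e f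
      equally-short⇒tie P Q P≢Q sp@((p , _) , _) sq@((q , _) , _) (P≈Q , P≡Q)
        with diverge K G P Q p q P≢Q P≈Q
      ... | W , e , X , f , Y , refl , refl , e≢f = e , f , e≢f ,
        IsPath-target K G W (proj₁ (IsPath-split K G W e X p)) (proj₁ (IsPath-split K G W f Y q)) ,
        lose (suffix-continuation W e X sp) (suffix-minimal W e X sp ,
          lose (suffix-continuation W f Y sq) (suffix-minimal W f Y sq ,
            ℕₚ.+-cancelˡ-≡ (nuance G ρ W) _ _ (trans (sym (nuance-++ K G ρ W (e ∷ X)))
              (trans P≡Q (nuance-++ K G ρ W (f ∷ Y))))))

-- Reversed networks

AllPairs-reverse : ∀ {a ℓ} {A : Set a} {R : A → A → Set ℓ} → (∀ {x y} → R x y → R y x) →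
  ∀ xs → AllPairs R xs → AllPairs R (reverse xs)
AllPairs-reverse R-sym []       []       = []
AllPairs-reverse {R = R} R-sym (x ∷ xs) (r ∷ rs) = subst (AllPairs R) (sym (unfold-reverse x xs))
  (AllPairsₚ.++⁺ (AllPairs-reverse R-sym xs rs) ([] ∷ [])
    (All.tabulate λ y∈ → R-sym (All.lookup r (Anyₚ.reverse⁻ y∈)) ∷ []))

module _ {c ℓ₁ ℓ₂} (K : OrderedField c ℓ₁ ℓ₂) {n : ℕ} where
  open OrderedField K
  open CommutativeRing commutativeRing using (+-congʳ; +-congˡ; +-comm; +-identityʳ)
    renaming (refl to ≈-refl; sym to ≈-sym; trans to ≈-trans)
  open RoadNetwork renaming (length to edgeLength; length>0 to edgeLength>0)

  OppositeConnected : RoadNetwork K n → Set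
  OppositeConnected G = ∀ u v → EqClosure (λ a b → ∃ λ e → tgt G e ≡ a × src G e ≡ b) u v

  opposite-connected : ∀ G → OppositeConnected G
  opposite-connected G u v = EqClosure.fold (EqClosure.isEquivalence _)
    (λ { (e , refl , refl) → EqClosure.symmetric _ (EqClosure.return (e , refl , refl)) })
    (connected G u v)

  -- Taking the connectedness proof as an argument makes the opposite of the
  -- opposite network definitionally equal to the network.
  opposite : (G : RoadNetwork K n) → OppositeConnected G → RoadNetwork K n
  opposite G connected = record
    { m = m G ; src = tgt G ; tgt = src G ; position = position G
    ; length = edgeLength G ; length>0 = edgeLength>0 G ; connected = connected }

  pathLength-reverse : ∀ (G : RoadNetwork K n) P → pathLength G (reverse P) ≈ pathLength G P
  pathLength-reverse G []      = ≈-refl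
  pathLength-reverse G (e ∷ P) rewrite unfold-reverse e P = ≈-trans
    (pathLength-++ K G (reverse P) (e ∷ []))
    (≈-trans (+-comm _ _) (≈-trans (+-congʳ (+-identityʳ _)) (+-congˡ (pathLength-reverse G P))))

  nuance-reverse : ∀ (G : RoadNetwork K n) {τ} (ρ : Fin (m G) → Fin τ) P →
    nuance G ρ (reverse P) ≡ nuance G ρ P
  nuance-reverse G ρ []      = refl
  nuance-reverse G ρ (e ∷ P) rewrite unfold-reverse e P = trans
    (nuance-++ K G ρ (reverse P) (e ∷ []))
    (trans (ℕₚ.+-comm (nuance G ρ (reverse P)) _)
      (cong₂ ℕ._+_ (ℕₚ.+-identityʳ _) (nuance-reverse G ρ P)))

  module _ (G : RoadNetwork K n) (G-connected : OppositeConnected G) where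

    private Gᵒ = opposite G G-connected

    IsPath-reverse : ∀ {s t} P → IsPath G s t P → IsPath Gᵒ t s (reverse P)
    IsPath-reverse []      p          = sym p
    IsPath-reverse {s} {t} (e ∷ P) (refl , p) = subst (IsPath Gᵒ t s) (sym (unfold-reverse e P))
      (IsPath-++ K Gᵒ (reverse P) (e ∷ []) (IsPath-reverse P p) (refl , refl))

    LocalPath-reverse : ∀ {B s t} P → InSquare K B (position G s) →
      LocalPath G B s t P → LocalPath Gᵒ B t s (reverse P)
    LocalPath-reverse {B} P s∈ (p , _ , local) =
      path , lose (target∈nodes K Gᵒ (reverse P) path) s∈ ,
      AllPairs-reverse (_∘ swap) P (AllPairs.map (λ ¬both (x , y) → ¬both (flip x , flip y)) local)
      where
      path = IsPath-reverse P p
      flip : ∀ {e} → CrossesBoundary Gᵒ B e → CrossesBoundary G B e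
      flip {e} = Crosses-sym K B (position G (tgt G e)) (position G (src G e))

    Shorter-reverse : ∀ {τ} (ρ : Fin (m G) → Fin τ) {P Q} → Shorter Gᵒ ρ Q P →
      Shorter G ρ (reverse Q) (reverse P)
    Shorter-reverse ρ {P} {Q} (inj₁ (le , ne)) = inj₁
      ( ≤-respˡ K (≈-sym (pathLength-reverse G Q)) (≤-respʳ K (≈-sym (pathLength-reverse G P)) le)
      , λ eq → ne (≈-trans (≈-sym (pathLength-reverse G Q)) (≈-trans eq (pathLength-reverse G P))))
    Shorter-reverse ρ {P} {Q} (inj₂ (eq , lt)) = inj₂
      ( ≈-trans (pathLength-reverse G Q) (≈-trans eq (≈-sym (pathLength-reverse G P)))
      , ≡.subst₂ ℕ._<_ (sym (nuance-reverse G ρ Q)) (sym (nuance-reverse G ρ P)) lt)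

    EquallyShort-reverse : ∀ {τ} (ρ : Fin (m G) → Fin τ) P Q → EquallyShort G ρ P Q →
      EquallyShort Gᵒ ρ (reverse P) (reverse Q)
    EquallyShort-reverse ρ P Q (eq , eq′) =
      ≈-trans (pathLength-reverse G P) (≈-trans eq (≈-sym (pathLength-reverse G Q))) ,
      trans (nuance-reverse G ρ P) (trans eq′ (sym (nuance-reverse G ρ Q)))

  LocalShortestPath-reverse : ∀ G G-connected {B s t τ} (ρ : Fin (m G) → Fin τ) P →
    InSquare K B (position G s) → LocalShortestPath G ρ B s t P →
    LocalShortestPath (opposite G G-connected) ρ B t s (reverse P)
  LocalShortestPath-reverse G G-connected {B} {s} {t} ρ P s∈ (local , shortest) =
    LocalPath-reverse G G-connected P s∈ local ,
    λ Q Q-local Q<P → shortest (reverse Q) (unreverse Q Q-local)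
      (subst (Shorter G ρ (reverse Q)) (reverse-involutive P)
        (Shorter-reverse G G-connected ρ {reverse P} {Q} Q<P))
    where
    Gᵒ = opposite G G-connected
    unreverse : ∀ Q → LocalPath Gᵒ B t s Q → LocalPath G B s t (reverse Q)
    unreverse Q (q , _ , local) =
      IsPath-reverse Gᵒ (connected G) Q q , here s∈ ,
      AllPairs-reverse (_∘ swap) Q (AllPairs.map (λ ¬both (x , y) → ¬both (flip x , flip y)) local)
      where
      flip : ∀ {e} → CrossesBoundary G B e → CrossesBoundary Gᵒ B e
      flip {e} = Crosses-sym K B (position G (src G e)) (position G (tgt G e))

  equally-short⇒tie-at-end : ∀ (G : RoadNetwork K n) G-connected {B s t τ}
    (ρ : Fin (m G) → Fin τ) P Q → P ≢ Q →
    LocalShortestPath G ρ B s t P → LocalShortestPath G ρ B s t Q → EquallyShort G ρ P Q →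
    (Inside K G B t × ∃ λ e → ∃ λ f → e ≢ f × src G e ≡ src G f × Tie K G B t ρ e f) ⊎
    (Inside K G B s × ∃ λ e → ∃ λ f → e ≢ f × tgt G e ≡ tgt G f ×
      Tie K (opposite G G-connected) B s ρ e f)
  equally-short⇒tie-at-end G G-connected {B} {s} {t} ρ P Q P≢Q sp sq eq
    with endpoint-inside K G B P (proj₁ sp)
  ... | inj₂ t∈ = inj₁ (t∈ , equally-short⇒tie K G B t ρ t∈ P Q P≢Q sp sq eq)
  ... | inj₁ s∈ = inj₂ (s∈ , equally-short⇒tie K (opposite G G-connected) B s ρ s∈
    (reverse P) (reverse Q) (P≢Q ∘ reverse-injective)
    (LocalShortestPath-reverse G G-connected ρ P s∈ sp)
    (LocalShortestPath-reverse G G-connected ρ Q s∈ sq)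
    (EquallyShort-reverse G G-connected ρ P Q eq))

-- The union bound

-- Enumerates a subset, so that sizes can be compared through injections between `Fin` types.
member : ∀ {k} (p : Subset k) → Fin ∣ p ∣ → Fin k
member (inside  ∷ p) zero    = zero
member (inside  ∷ p) (suc i) = suc (member p i)
member (outside ∷ p) i       = suc (member p i)

member∈ : ∀ {k} (p : Subset k) i → member p i Subset.∈ p
member∈ (inside  ∷ p) zero    = Vec.here
member∈ (inside  ∷ p) (suc i) = Vec.there (member∈ p i)
member∈ (outside ∷ p) i       = Vec.there (member∈ p i)

member-injective : ∀ {k} (p : Subset k) {i j} → member p i ≡ member p j → i ≡ j
member-injective (inside  ∷ p) {zero}  {zero}  eq = refl
member-injective (inside  ∷ p) {suc i} {suc j} eq = cong suc (member-injective p (suc-injective eq))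
member-injective (outside ∷ p) eq = member-injective p (suc-injective eq)

∣p∣≤∣p∩∁q∣+∣q∣ : ∀ {k} (p q : Subset k) → ∣ p ∣ ℕ.≤ ∣ p ∩ ∁ q ∣ ℕ.+ ∣ q ∣
∣p∣≤∣p∩∁q∣+∣q∣ []            []            = ℕ.z≤n
∣p∣≤∣p∩∁q∣+∣q∣ (inside  ∷ p) (inside  ∷ q) =
  subst (suc ∣ p ∣ ℕ.≤_) (sym (ℕₚ.+-suc _ _)) (ℕ.s≤s (∣p∣≤∣p∩∁q∣+∣q∣ p q))
∣p∣≤∣p∩∁q∣+∣q∣ (inside  ∷ p) (outside ∷ q) = ℕ.s≤s (∣p∣≤∣p∩∁q∣+∣q∣ p q)
∣p∣≤∣p∩∁q∣+∣q∣ (outside ∷ p) (inside  ∷ q) =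
  ℕₚ.≤-trans (∣p∣≤∣p∩∁q∣+∣q∣ p q) (ℕₚ.+-monoʳ-≤ ∣ p ∩ ∁ q ∣ (ℕₚ.n≤1+n _))
∣p∣≤∣p∩∁q∣+∣q∣ (outside ∷ p) (outside ∷ q) = ∣p∣≤∣p∩∁q∣+∣q∣ p q

module _ {a} {k : ℕ} {P : Fin k → Set a} (P? : ∀ i → Dec (P i)) where

  decided : Subset k
  decided = Vec.tabulate (does ∘ P?)

  ∈-decided⁺ : ∀ {i} → P i → i Subset.∈ decided
  ∈-decided⁺ {i} p = lookup⇒[]= i decided (trans (lookup∘tabulate (does ∘ P?) i) (dec-true (P? i) p))

  ∈-decided⁻ : ∀ {i} → i Subset.∈ decided → P i
  ∈-decided⁻ {i} i∈ with P? i | trans (sym (lookup∘tabulate (does ∘ P?) i)) ([]=⇒lookup i∈)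
  ... | yes p | _ = p

funToFin-cong : ∀ {m τ} {f g : Fin m → Fin τ} → (∀ i → f i ≡ g i) → funToFin f ≡ funToFin g
funToFin-cong {zero}  eq = refl
funToFin-cong {suc m} eq = cong₂ combine (eq zero) (funToFin-cong (eq ∘ suc))

-- The combinatorial form of a conditional probability of at most `1/τ`, given the nuances of all
-- edges other than `e`.
Determines : ∀ {a m τ} → Fin m → ((Fin m → Fin τ) → Set a) → Set a
Determines e A = ∀ ρ ρ′ → (∀ f → f ≢ e → ρ f ≡ ρ′ f) → A ρ → A ρ′ → ρ e ≡ ρ′ e

module _ {a} {m τ : ℕ} {A : (Fin m → Fin τ) → Set a} (A? : ∀ ρ → Dec (A ρ)) where

  outcomes : Subset (τ ℕ.^ m)
  outcomes = decided (A? ∘ finToFun)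

  -- Overwriting the determined coordinate arbitrarily is injective on outcomes.
  determined-size : ∀ e → Determines e A → ∣ outcomes ∣ ℕ.* τ ℕ.≤ τ ℕ.^ m
  determined-size e determines = injective⇒≤ {f = overwrite} overwrite-injective
    where
    outcome : Fin (∣ outcomes ∣ ℕ.* τ) → Fin m → Fin τ
    outcome x = finToFun (member outcomes (proj₁ (remQuot τ x)))
    value : Fin (∣ outcomes ∣ ℕ.* τ) → Fin τ
    value x = proj₂ (remQuot {∣ outcomes ∣} τ x)
    overwritten : Fin (∣ outcomes ∣ ℕ.* τ) → Fin m → Fin τ
    overwritten x = updateAt (outcome x) e (const (value x))
    overwrite : Fin (∣ outcomes ∣ ℕ.* τ) → Fin (τ ℕ.^ m)
    overwrite x = funToFin (overwritten x)
    overwrite-injective : ∀ {x y} → overwrite x ≡ overwrite y → x ≡ y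
    overwrite-injective {x} {y} eq = trans (sym (combine-remQuot {∣ outcomes ∣} τ x))
      (trans (cong₂ combine same-outcome same-value) (combine-remQuot {∣ outcomes ∣} τ y))
      where
      pointwise : ∀ f → overwritten x f ≡ overwritten y f
      pointwise f = trans (sym (finToFun-funToFin (overwritten x) f))
        (trans (cong (λ z → finToFun z f) eq) (finToFun-funToFin (overwritten y) f))
      same-value : value x ≡ value y
      same-value = trans (sym (updateAt-updates e (outcome x)))
        (trans (pointwise e) (updateAt-updates e (outcome y)))
      off-e : ∀ f → f ≢ e → outcome x f ≡ outcome y f
      off-e f f≢e = trans (sym (updateAt-minimal f e (outcome x) f≢e))
        (trans (pointwise f) (updateAt-minimal f e (outcome y) f≢e))
      at-e : outcome x e ≡ outcome y e
      at-e = determines (outcome x) (outcome y) off-e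
        (∈-decided⁻ (A? ∘ finToFun) (member∈ outcomes _))
          (∈-decided⁻ (A? ∘ finToFun) (member∈ outcomes _))
      everywhere : ∀ f → outcome x f ≡ outcome y f
      everywhere f with f Finₚ.≟ e
      ... | yes refl = at-e
      ... | no f≢e   = off-e f f≢e
      same-outcome : proj₁ (remQuot τ x) ≡ proj₁ (remQuot τ y)
      same-outcome = member-injective outcomes
        (trans (sym (funToFin-finToFin {m} {τ} _))
          (trans (funToFin-cong everywhere) (funToFin-finToFin {m} {τ} _)))

module _ {a b} {E : Set b} {m τ : ℕ} {A : E → (Fin m → Fin τ) → Set a}
         (A? : ∀ E ρ → Dec (A E ρ)) where

  avoiding : List E → Subset (τ ℕ.^ m)
  avoiding []       = ⊤
  avoiding (E ∷ Es) = avoiding Es ∩ ∁ (outcomes (A? E))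

  avoiding⇒¬ : ∀ Es {ω} → ω Subset.∈ avoiding Es → All (λ E → ¬ A E (finToFun ω)) Es
  avoiding⇒¬ []       ω∈ = []
  avoiding⇒¬ (E ∷ Es) ω∈ with x∈p∩q⁻ (avoiding Es) (∁ (outcomes (A? E))) ω∈
  ... | ω∈Es , ω∈∁E = (x∈∁p⇒x∉p ω∈∁E ∘ ∈-decided⁺ (A? E ∘ finToFun)) ∷ avoiding⇒¬ Es ω∈Es

  -- Divided by `τ ^ m * τ`, this bounds the probability of avoiding all events from below by
  -- `1 - length Es / τ`. The multiplied form stays within the naturals and needs no subtraction.
  union-bound : ∀ Es → All (λ E → ∃ λ e → Determines e (A E)) Es →
    τ ℕ.^ m ℕ.* τ ℕ.≤ ∣ avoiding Es ∣ ℕ.* τ ℕ.+ length Es ℕ.* τ ℕ.^ m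
  union-bound []       []                 = ℕₚ.≤-reflexive
    (sym (trans (ℕₚ.+-identityʳ _) (cong (ℕ._* τ) (∣⊤∣≡n (τ ℕ.^ m)))))
  union-bound (E ∷ Es) ((e , determines) ∷ ds) = begin
    τ ℕ.^ m ℕ.* τ
      ≤⟨ union-bound Es ds ⟩
    ∣ S ∣ ℕ.* τ ℕ.+ length Es ℕ.* τ ℕ.^ m
      ≤⟨ ℕₚ.+-monoˡ-≤ _ (ℕₚ.*-monoˡ-≤ τ (∣p∣≤∣p∩∁q∣+∣q∣ S X)) ⟩
    (∣ S′ ∣ ℕ.+ ∣ X ∣) ℕ.* τ ℕ.+ length Es ℕ.* τ ℕ.^ m
      ≡⟨ cong (ℕ._+ length Es ℕ.* τ ℕ.^ m) (ℕₚ.*-distribʳ-+ τ ∣ S′ ∣ ∣ X ∣) ⟩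
    ∣ S′ ∣ ℕ.* τ ℕ.+ ∣ X ∣ ℕ.* τ ℕ.+ length Es ℕ.* τ ℕ.^ m
      ≤⟨ ℕₚ.+-monoˡ-≤ _ (ℕₚ.+-monoʳ-≤ (∣ S′ ∣ ℕ.* τ) (determined-size (A? E) e determines)) ⟩
    ∣ S′ ∣ ℕ.* τ ℕ.+ τ ℕ.^ m ℕ.+ length Es ℕ.* τ ℕ.^ m
      ≡⟨ ℕₚ.+-assoc (∣ S′ ∣ ℕ.* τ) _ _ ⟩
    ∣ S′ ∣ ℕ.* τ ℕ.+ (τ ℕ.^ m ℕ.+ length Es ℕ.* τ ℕ.^ m) ∎
    where
    open ℕₚ.≤-Reasoning
    S = avoiding Es
    X = outcomes (A? E)
    S′ = S ∩ ∁ X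

-- With `1/n` moved to the other side, the claim becomes an inequality for a sum. Over unnormalised
-- rationals it is the hypothesis after cross multiplication, with no reduction to lowest terms.
1-1/n≤ : ∀ n .{{_ : NonZero n}} N .{{_ : NonZero N}} s → n ℕ.* N ℕ.≤ n ℕ.* s ℕ.+ N →
  1ℚ ℚ.- (+ 1) ℚ./ n ℚ.≤ (+ s) ℚ./ N
1-1/n≤ n@(suc n-1) N@(suc N-1) s bound = subst (1ℚ ℚ.- 1/n ℚ.≤_) cancel (ℚₚ.+-monoˡ-≤ (ℚ.- 1/n) 1≤)
  where
  1/n = (+ 1) ℚ./ n
  s/N = (+ s) ℚ./ N
  cancel : s/N ℚ.+ 1/n ℚ.- 1/n ≡ s/N
  cancel = trans (ℚₚ.+-assoc s/N 1/n (ℚ.- 1/n))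
    (trans (cong (s/N ℚ.+_) (ℚₚ.+-inverseʳ 1/n)) (ℚₚ.+-identityʳ s/N))
  numerators : + 1 ℤ.* + (N ℕ.* n) ℤ.≤ (+ s ℤ.* + n ℤ.+ + 1 ℤ.* + N) ℤ.* + 1
  numerators = ≡.subst₂ ℤ._≤_
    (trans (cong +_ (ℕₚ.*-comm n N)) (sym (ℤₚ.*-identityˡ _)))
    (trans (ℤₚ.pos-+ (n ℕ.* s) N) (trans (cong₂ ℤ._+_
      (trans (cong +_ (ℕₚ.*-comm n s)) (ℤₚ.pos-* s n)) (sym (ℤₚ.*-identityˡ (+ N))))
        (sym (ℤₚ.*-identityʳ _))))
    (ℤ.+≤+ bound)
  1≤ : 1ℚ ℚ.≤ s/N ℚ.+ 1/n
  1≤ = ℚₚ.toℚᵘ-cancel-≤ (ℚᵘₚ.≤-respʳ-≃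
    (ℚᵘₚ.≃-sym (ℚᵘₚ.≃-trans (ℚₚ.toℚᵘ-homo-+ s/N 1/n)
      (ℚᵘₚ.+-cong (ℚₚ.toℚᵘ-fromℚᵘ (ℚᵘ.mkℚᵘ (+ s) N-1)) (ℚₚ.toℚᵘ-fromℚᵘ (ℚᵘ.mkℚᵘ (+ 1) n-1)))))
    (ℚᵘ.*≤* numerators))

-- Counting the possible ties

[1+n]C2 : ∀ n → suc n C 2 ≡ n ℕ.+ n C 2
[1+n]C2 n = trans (sym (nCk+nC[k+1]≡[n+1]C[k+1] n 1)) (cong (ℕ._+ n C 2) (nC1≡n n))

-- Pairs within two disjoint classes are pairs within their union. For the edges leaving and those
-- entering a node, this fits both kinds of forks into one binomial coefficient of the degree.
C2-superadditive : ∀ a b → a C 2 ℕ.+ b C 2 ℕ.≤ (a ℕ.+ b) C 2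
C2-superadditive zero    b = ℕₚ.≤-refl
C2-superadditive (suc a) b = begin
  suc a C 2 ℕ.+ b C 2                ≡⟨ cong (ℕ._+ b C 2) ([1+n]C2 a) ⟩
  a ℕ.+ a C 2 ℕ.+ b C 2              ≡⟨ ℕₚ.+-assoc a _ _ ⟩
  a ℕ.+ (a C 2 ℕ.+ b C 2)            ≤⟨ ℕₚ.+-mono-≤ (ℕₚ.m≤m+n a b) (C2-superadditive a b) ⟩
  (a ℕ.+ b) ℕ.+ (a ℕ.+ b) C 2        ≡⟨ [1+n]C2 (a ℕ.+ b) ⟨
  suc (a ℕ.+ b) C 2                  ∎
  where open ℕₚ.≤-Reasoning

C2-mono : ∀ {a b} → a ℕ.≤ b → a C 2 ℕ.≤ b C 2
C2-mono {a} {b} a≤b = subst (λ z → a C 2 ℕ.≤ z C 2) (ℕₚ.m+[n∸m]≡n a≤b)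
  (ℕₚ.≤-trans (ℕₚ.m≤m+n (a C 2) _) (C2-superadditive a (b ℕ.∸ a)))

-- Each pair of positions is listed in one orientation only, which avoids a factor 2 in the number
-- of events; `tie-sym` supplies the other orientation.
pairs : ∀ {a} {A : Set a} → List A → List (A × A)
pairs []       = []
pairs (x ∷ xs) = map (x ,_) xs ++ pairs xs

length-pairs : ∀ {a} {A : Set a} (xs : List A) → length (pairs xs) ≡ length xs C 2
length-pairs []       = refl
length-pairs (x ∷ xs) = trans (length-++ (map (x ,_) xs))
  (trans (cong₂ ℕ._+_ (length-map _ xs) (length-pairs xs)) (sym ([1+n]C2 (length xs))))

∈-pairs : ∀ {a} {A : Set a} {x y : A} {xs} → x ∈ xs → y ∈ xs → x ≢ y →
  (x , y) ∈ pairs xs ⊎ (y , x) ∈ pairs xs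
∈-pairs (here refl) (here refl) x≢y = contradiction refl x≢y
∈-pairs (here refl) (there y∈)  x≢y = inj₁ (∈-++⁺ˡ (∈-map⁺ _ y∈))
∈-pairs (there x∈)  (here refl) x≢y = inj₂ (∈-++⁺ˡ (∈-map⁺ _ x∈))
∈-pairs {xs = x ∷ xs} (there x∈) (there y∈) x≢y =
  [ inj₁ ∘ ∈-++⁺ʳ (map (x ,_) xs) , inj₂ ∘ ∈-++⁺ʳ (map (x ,_) xs) ]′ (∈-pairs x∈ y∈ x≢y)

AllPairs⇒All-pairs : ∀ {a ℓ} {A : Set a} {R : A → A → Set ℓ} {xs} →
  AllPairs R xs → All (λ (x , y) → R x y) (pairs xs)
AllPairs⇒All-pairs []       = []
AllPairs⇒All-pairs (r ∷ rs) = Allₚ.++⁺ (Allₚ.map⁺ r) (AllPairs⇒All-pairs rs)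

-- The two lists are bounded jointly because the forks out of a node and those into it share one
-- budget; separate bounds would double the count.
length-concatMap-+ : ∀ {a b c} {A : Set a} {B : Set b} {C : Set c} (f : A → List B) (g : A → List C) k →
  (∀ x → length (f x) ℕ.+ length (g x) ℕ.≤ k) →
  ∀ xs → length (concatMap f xs) ℕ.+ length (concatMap g xs) ℕ.≤ length xs ℕ.* k
length-concatMap-+ f g k bound []       = ℕ.z≤n
length-concatMap-+ f g k bound (x ∷ xs) = begin
  length (f x ++ concatMap f xs) ℕ.+ length (g x ++ concatMap g xs)
    ≡⟨ cong₂ ℕ._+_ (length-++ (f x)) (length-++ (g x)) ⟩
  (length (f x) ℕ.+ F) ℕ.+ (length (g x) ℕ.+ G)
    ≡⟨ interchange (length (f x)) F (length (g x)) G ⟩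
  (length (f x) ℕ.+ length (g x)) ℕ.+ (F ℕ.+ G)
    ≤⟨ ℕₚ.+-mono-≤ (bound x) (length-concatMap-+ f g k bound xs) ⟩
  k ℕ.+ length xs ℕ.* k ∎
  where
  open ℕₚ.≤-Reasoning
  open Algebra.Properties.CommutativeSemigroup ℕₚ.+-commutativeSemigroup using (interchange)
  F = length (concatMap f xs)
  G = length (concatMap g xs)

length-concatMap : ∀ {a b} {A : Set a} {B : Set b} (f : A → List B) k → (∀ x → length (f x) ℕ.≤ k) →
  ∀ xs → length (concatMap f xs) ℕ.≤ length xs ℕ.* k
length-concatMap f k bound []       = ℕ.z≤n
length-concatMap f k bound (x ∷ xs) = ℕₚ.≤-trans (ℕₚ.≤-reflexive (length-++ (f x)))
  (ℕₚ.+-mono-≤ (bound x) (length-concatMap f k bound xs))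

length-cartesianProduct : ∀ {a b} {A : Set a} {B : Set b} (xs : List A) (ys : List B) →
  length (cartesianProduct xs ys) ≡ length xs ℕ.* length ys
length-cartesianProduct []       ys = refl
length-cartesianProduct (x ∷ xs) ys = trans (length-++ (map (x ,_) ys))
  (cong₂ ℕ._+_ (length-map (x ,_) ys) (length-cartesianProduct xs ys))

length-increasing : ∀ a k {xs} → AllPairs ℕ._<_ xs → All (λ x → a ℕ.≤ x × x ℕ.< a ℕ.+ k) xs →
  length xs ℕ.≤ k
length-increasing a k       []         []                   = ℕ.z≤n
length-increasing a zero    (lt ∷ lts) ((a≤x , x<a) ∷ _)    =
  contradiction (ℕₚ.<-≤-trans x<a (ℕₚ.≤-reflexive (ℕₚ.+-identityʳ a))) (ℕₚ.≤⇒≯ a≤x)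
length-increasing a (suc k) (lt ∷ lts) ((a≤x , _) ∷ bounds) = ℕ.s≤s (length-increasing (suc a) k lts
  (All.zipWith (λ { {y} (x<y , _ , y<) → ℕₚ.≤-<-trans a≤x x<y , subst (y ℕ.<_) (ℕₚ.+-suc a k) y< })
    (lt , bounds)))

length-filter-tabulate : ∀ {a b p} {A : Set a} {B : Set b} {P : Pred B p} (P? : Decidable P)
  (f : A → B) →
  ∀ {m} (g : Fin m → A) → length (filter (P? ∘ f) (List.tabulate g)) ≡ count P? (tabulate (f ∘ g))
length-filter-tabulate P? f {zero}  g = refl
length-filter-tabulate P? f {suc m} g with does (P? (f (g zero)))
... | true  = cong suc (length-filter-tabulate P? f (g ∘ suc))
... | false = length-filter-tabulate P? f (g ∘ suc)

module _ {m n : ℕ} (end : Fin m → Fin n) where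

  edgesAt : Fin n → List (Fin m)
  edgesAt v = filter (λ e → end e Finₚ.≟ v) (allFin m)

  forks : List (Fin m × Fin m)
  forks = concatMap (pairs ∘ edgesAt) (allFin n)

  ∈-forks : ∀ {e f} → e ≢ f → end e ≡ end f → (e , f) ∈ forks ⊎ (f , e) ∈ forks
  ∈-forks {e} {f} e≢f same = [ inj₁ ∘ collect , inj₂ ∘ collect ]′ (∈-pairs
    (∈-filter⁺ (λ e → end e Finₚ.≟ end f) (∈-allFin e) same)
    (∈-filter⁺ (λ e → end e Finₚ.≟ end f) (∈-allFin f) refl) e≢f)
    where
    collect : ∀ {p} → p ∈ pairs (edgesAt (end f)) → p ∈ forks
    collect p∈ = ∈-concatMap⁺ (pairs ∘ edgesAt) (lose (∈-allFin (end f)) p∈)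

  forks-distinct : All (λ (e , f) → e ≢ f × end e ≡ end f) forks
  forks-distinct = Allₚ.concat⁺ (Allₚ.map⁺ (All.universal distinct (allFin n)))
    where
    distinct : ∀ v → All (λ (e , f) → e ≢ f × end e ≡ end f) (pairs (edgesAt v))
    distinct v = AllPairs⇒All-pairs (AllPairs.zipWith id
      ( Uniqueₚ.filter⁺ (λ e → end e Finₚ.≟ v) (Uniqueₚ.allFin⁺ m)
      , all-pairs (edgesAt v) λ e∈ f∈ → trans (ends e∈) (sym (ends f∈))))
      where
      ends : ∀ {e} → e ∈ edgesAt v → end e ≡ v
      ends e∈ = proj₂ (∈-filter⁻ (λ e → end e Finₚ.≟ v) {xs = allFin m} e∈)
      all-pairs : ∀ xs → (∀ {e f} → e ∈ xs → f ∈ xs → end e ≡ end f) →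
        AllPairs (λ e f → end e ≡ end f) xs
      all-pairs []       _   = []
      all-pairs (x ∷ xs) all = All.tabulate (all (here refl) ∘ there) ∷
        all-pairs xs (λ e∈ f∈ → all (there e∈) (there f∈))

module _ {c ℓ₁ ℓ₂} (K : OrderedField c ℓ₁ ℓ₂) {n : ℕ} (G : RoadNetwork K n) where
  open RoadNetwork G using (m; src; tgt)

  degree≤maxDegree : ∀ v → degree G v ℕ.≤ maxDegree G
  degree≤maxDegree v = All.lookup (xs≤max 0 (map (degree G) (allFin n)))
    (∈-map⁺ (degree G) (∈-allFin v))

  length-forks : length (forks src) ℕ.+ length (forks tgt) ℕ.≤ n ℕ.* (maxDegree G C 2)
  length-forks = subst (λ k → length (forks src) ℕ.+ length (forks tgt) ℕ.≤ k ℕ.* (maxDegree G C 2))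
    (length-tabulate {n = n} id)
    (length-concatMap-+ (pairs ∘ edgesAt src) (pairs ∘ edgesAt tgt) (maxDegree G C 2) bound (allFin n))
    where
    count-pairs : ∀ (end : Fin m → Fin n) v →
      length (pairs (edgesAt end v)) ≡ count (Finₚ._≟ v) (tabulate end) C 2
    count-pairs end v = trans (length-pairs (edgesAt end v))
      (cong (_C 2) (length-filter-tabulate (Finₚ._≟ v) end id))
    bound : ∀ v → length (pairs (edgesAt src v)) ℕ.+ length (pairs (edgesAt tgt v)) ℕ.≤ maxDegree G C 2
    bound v = ℕₚ.≤-trans (ℕₚ.≤-reflexive (cong₂ ℕ._+_ (count-pairs src v) (count-pairs tgt v)))
      (ℕₚ.≤-trans (C2-superadditive (count (Finₚ._≟ v) (tabulate src)) _)
        (C2-mono (degree≤maxDegree v)))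

-- Regions that contain a given node

module _ {c ℓ₁ ℓ₂} (K : OrderedField c ℓ₁ ℓ₂) where
  open OrderedField K
  open IsDecTotalOrder isDecTotalOrder using (_≤?_) renaming (refl to ≤-refl; trans to ≤-trans)
  open CommutativeRing commutativeRing using (+-monoid; +-congˡ; +-assoc; +-identityʳ)
    renaming (refl to ≈-refl; sym to ≈-sym; trans to ≈-trans)
  open Algebra.Properties.Monoid.Mult +-monoid using (×-homo-+)

  ·-nonNegative : ∀ k {x} → 0# ≤ x → 0# ≤ k · x
  ·-nonNegative zero    0≤x = ≤-refl
  ·-nonNegative (suc k) 0≤x = 0≤-+ K 0≤x (·-nonNegative k 0≤x)

  ·-nonPositive : ∀ k {x} → x ≤ 0# → k · x ≤ 0#
  ·-nonPositive zero    x≤0 = ≤-refl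
  ·-nonPositive (suc k) x≤0 = ≤-respʳ K (+-identityʳ 0#) (+-mono-≤ K x≤0 (·-nonPositive k x≤0))

  ·-positive : ∀ k {x} → 0 ℕ.< k → ¬ (x ≤ 0#) → ¬ (k · x ≤ 0#)
  ·-positive (suc k) {x} _ x≰0 le = x≰0 (≤-trans
    (≤-respˡ K (+-identityʳ x) (+-mono-≤ K ≤-refl (·-nonNegative k (≰⇒≥ K x≰0)))) le)

  ·-cancel-nonNegative : ∀ k {x} → x ≤ 0# → 0 ℕ.< k → 0# ≤ k · x → 0# ≤ x
  ·-cancel-nonNegative (suc k) {x} x≤0 _ le = ≤-trans le
    (≤-respʳ K (+-identityʳ x) (+-mono-≤ K ≤-refl (·-nonPositive k x≤0)))

  Near : Carrier → Carrier → Carrier → ℕ → Set _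
  Near lo w x a = (lo + a · w ≤ x) × (x ≤ lo + a · w + 4 · w)

  near? : ∀ lo w x a → Dec (Near lo w x a)
  near? lo w x a = (_ ≤? _) ×-dec (_ ≤? _)

  -- Blocks of four cells are closed, so those at offsets `a` and `a + 4` still share a boundary
  -- line. From offset `a + 5` on there is a gap, which is why five offsets per axis are possible
  -- and not four.
  near-bound : ∀ {lo w x} → ¬ (w ≤ 0#) → ∀ {a b} → Near lo w x a → Near lo w x b → b ℕ.< a ℕ.+ 5
  near-bound {lo} {w} {x} w>0 {a} {b} (_ , x≤) (≤x , _) = ℕₚ.≰⇒> λ a+5≤b →
    far (b ℕ.∸ (a ℕ.+ 5)) (trans (sym (ℕₚ.m+[n∸m]≡n a+5≤b)) (shuffle (b ℕ.∸ (a ℕ.+ 5))))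
    where
    shuffle : ∀ d → a ℕ.+ 5 ℕ.+ d ≡ a ℕ.+ (4 ℕ.+ suc d)
    shuffle d = ℕₚ.+-assoc a 5 d
    far : ∀ d → ¬ (b ≡ a ℕ.+ (4 ℕ.+ suc d))
    far d refl = ·-positive (suc d) {w} ℕ.z<s w>0 (+-cancelˡ-≤ K _
      (≤-respʳ K (≈-sym (+-identityʳ _)) (≤-trans (≤-respˡ K expand ≤x) x≤)))
      where
      expand : lo + (a ℕ.+ (4 ℕ.+ suc d)) · w ≈ (lo + a · w + 4 · w) + suc d · w
      expand = ≈-trans (+-congˡ (≈-trans (×-homo-+ w a (4 ℕ.+ suc d)) (+-congˡ (×-homo-+ w 4 (suc d)))))
        (≈-trans (≈-sym (+-assoc _ _ _)) (≈-sym (+-assoc _ _ _)))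

  offsets : Carrier → Carrier → Carrier → ℕ → List ℕ
  offsets lo w x k = filter (near? lo w x) (upTo k)

  length-offsets : ∀ {lo w x} → ¬ (w ≤ 0#) → ∀ k → length (offsets lo w x k) ℕ.≤ 5
  length-offsets {lo} {w} {x} w>0 k = bound (offsets lo w x k)
    (AllPairsₚ.filter⁺ (near? lo w x) (AllPairsₚ.applyUpTo⁺₁ id k (λ i<j _ → i<j)))
    (Allₚ.all-filter (near? lo w x) (upTo k))
    where
    bound : ∀ xs → AllPairs ℕ._<_ xs → All (Near lo w x) xs → length xs ℕ.≤ 5
    bound []       _               _             = ℕ.z≤n
    bound (a ∷ as) inc@(lt ∷ _) near@(na ∷ nas) = length-increasing a 5 inc
      ((ℕₚ.≤-refl , near-bound w>0 na na) ∷ All.zipWith (λ (a<b , nb) →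
        ℕₚ.<⇒≤ a<b , near-bound w>0 na nb) (lt , nas))

  module _ {n : ℕ} (G : RoadNetwork K n) {h : ℕ} (R : Grids G h) where
    open RoadNetwork G using (position)
    open Grids R

    -- Four consecutive cells out of `cellsPerAxis i` can start at `cellsPerAxis i ∸ 3` offsets.
    columns rows : ℕ → Fin n → List ℕ
    columns i t = offsets left (cellSide i) (proj₁ (position t)) (cellsPerAxis i ℕ.∸ 3)
    rows i t = offsets bottom (cellSide i) (proj₂ (position t)) (cellsPerAxis i ℕ.∸ 3)

    regionsAt : Fin n → ℕ → List (Fin n × Square K)
    regionsAt t i = map (λ (a , b) → t , block i 4 a b) (cartesianProduct (columns i t) (rows i t))

    regions : Fin n → List (Fin n × Square K)
    regions t = concatMap (regionsAt t) (upTo (suc h))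

    places : List (Fin n × Square K)
    places = concatMap regions (allFin n)

    ∈-places : ∀ {i} → i ℕ.≤ h → (B : Region G R i) → ∀ {t} → InSquare K (Region.area B) (position t) →
      (t , Region.area B) ∈ places
    ∈-places {i} i≤h B {t} ((l , r) , b , u) = ∈-concatMap⁺ regions (lose (∈-allFin t)
      (∈-concatMap⁺ (regionsAt t) (lose (∈-upTo⁺ (ℕ.s≤s i≤h))
        (∈-map⁺ (λ (a , b) → t , block i 4 a b) (∈-cartesianProduct⁺
          (∈-filter⁺ (near? left (cellSide i) (proj₁ (position t)))
            (∈-upTo⁺ (fits (Region.column-fits B))) (l , r))
          (∈-filter⁺ (near? bottom (cellSide i) (proj₂ (position t)))
            (∈-upTo⁺ (fits (Region.row-fits B))) (b , u)))))))
      where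
      fits : ∀ {a k} → a ℕ.+ 4 ℕ.≤ k → a ℕ.< k ℕ.∸ 3
      fits {a} {k} le = ℕₚ.m+n≤o⇒m≤o∸n (suc a) (subst (ℕ._≤ k) (ℕₚ.+-suc a 3) le)

    length-regionsAt : ∀ t i → length (regionsAt t i) ≡ length (columns i t) ℕ.* length (rows i t)
    length-regionsAt t i = trans (length-map _ (cartesianProduct (columns i t) (rows i t)))
      (length-cartesianProduct (columns i t) (rows i t))

    -- A node lies in at most 5 × 5 regions of each grid, and R_h is a single region.
    length-regions : ¬ (δ ≤ 0#) → ∀ t → length (regions t) ℕ.≤ 32 ℕ.* h
    length-regions δ>0 t = begin
      length (regions t)
        ≡⟨ cong (length ∘ concatMap (regionsAt t)) (upTo-∷ʳ h) ⟨
      length (concatMap (regionsAt t) (upTo h ++ h ∷ []))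
        ≡⟨ cong length (concatMap-++ (regionsAt t) (upTo h) (h ∷ [])) ⟩
      length (concatMap (regionsAt t) (upTo h) ++ concatMap (regionsAt t) (h ∷ []))
        ≡⟨ length-++ (concatMap (regionsAt t) (upTo h)) ⟩
      length (concatMap (regionsAt t) (upTo h)) ℕ.+ length (concatMap (regionsAt t) (h ∷ []))
        ≤⟨ ℕₚ.+-mono-≤ (length-concatMap (regionsAt t) 25 each (upTo h)) last ⟩
      length (upTo h) ℕ.* 25 ℕ.+ 1
        ≡⟨ cong (λ a → a ℕ.* 25 ℕ.+ 1) (length-upTo h) ⟩
      -- The single region of the coarsest grid is absorbed through `1 ≤ h ≤ 7h`, where 7 is what 32
      -- leaves beyond 25.
      h ℕ.* 25 ℕ.+ 1     ≤⟨ ℕₚ.+-monoʳ-≤ (h ℕ.* 25) (ℕₚ.≤-trans 1≤h (ℕₚ.m≤m*n h 7)) ⟩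
      h ℕ.* 25 ℕ.+ h ℕ.* 7 ≡⟨ ℕₚ.*-distribˡ-+ h 25 7 ⟨
      h ℕ.* 32           ≡⟨ ℕₚ.*-comm h 32 ⟩
      32 ℕ.* h           ∎
      where
      open ℕₚ.≤-Reasoning
      cellSide>0 : ∀ i → ¬ (cellSide i ≤ 0#)
      cellSide>0 i = ·-positive (2 ℕ.^ i) (ℕₚ.m^n>0 2 i) δ>0
      each : ∀ i → length (regionsAt t i) ℕ.≤ 25
      each i = ℕₚ.≤-trans (ℕₚ.≤-reflexive (length-regionsAt t i))
        (ℕₚ.*-mono-≤ (length-offsets (cellSide>0 i) (cellsPerAxis i ℕ.∸ 3))
          (length-offsets (cellSide>0 i) (cellsPerAxis i ℕ.∸ 3)))
      -- The coarsest grid has four cells per axis, so offset 0 is the only candidate.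
      single : ∀ lo x → length (offsets lo (cellSide h) x (cellsPerAxis h ℕ.∸ 3)) ℕ.≤ 1
      single lo x = ℕₚ.≤-trans (length-filter (near? lo (cellSide h) x) (upTo (cellsPerAxis h ℕ.∸ 3)))
        (ℕₚ.≤-reflexive (trans (length-upTo (cellsPerAxis h ℕ.∸ 3))
          (cong (λ k → 2 ℕ.^ k ℕ.∸ 3) (ℕₚ.m+n∸m≡n h 2))))
      last : length (concatMap (regionsAt t) (h ∷ [])) ℕ.≤ 1
      last = ℕₚ.≤-trans (ℕₚ.≤-reflexive (trans (length-++ (regionsAt t h))
        (trans (ℕₚ.+-identityʳ _) (length-regionsAt t h))))
        (ℕₚ.*-mono-≤ (single left (proj₁ (position t))) (single bottom (proj₂ (position t))))

    length-places : ¬ (δ ≤ 0#) → length places ℕ.≤ n ℕ.* (32 ℕ.* h)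
    length-places δ>0 = subst (λ k → length places ℕ.≤ k ℕ.* (32 ℕ.* h)) (length-tabulate {n = n} id)
      (length-concatMap regions (32 ℕ.* h) (length-regions δ>0) (allFin n))

    -- Covering a node forces `0# ≤ δ`. If also `δ ≤ 0#`, the whole square is no larger than one
    -- cell, so all nodes lie in the corner cell of the grid with index 1, and `stops` identifies
    -- them.
    δ-positive : ∀ {u v : Fin n} → u ≢ v → ¬ (δ ≤ 0#)
    δ-positive {u} {v} u≢v δ≤0 = u≢v (stops 0 0 cells>0 cells>0 u v (corner u) (corner v))
      where
      cells>0 : 0 ℕ.< cellsPerAxis 1
      cells>0 = ℕₚ.m^n>0 2 (h ℕ.+ 2 ℕ.∸ 1)
      0≤δ : 0# ≤ δ
      0≤δ with covers u
      ... | (l , r) , _ = ·-cancel-nonNegative 1 δ≤0 ℕ.z<s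
        (·-cancel-nonNegative (cellsPerAxis 0) (·-nonPositive 1 δ≤0) (ℕₚ.m^n>0 2 (h ℕ.+ 2))
          (≤-respʳ K (solve 2 (λ x y → x :+ y :- x := y) ≈-refl _ _) (≤⇒0≤- K (≤-trans l r))))
        where open Solver K using (solve; _:=_; _:+_; _:-_)
      shrink : ∀ {lo x} → x ≤ lo + 0# + cellsPerAxis 0 · cellSide 0 → x ≤ lo + 0# + 1 · cellSide 1
      shrink x≤ = ≤-trans x≤ (+-mono-≤ K ≤-refl
        (≤-trans (·-nonPositive (cellsPerAxis 0) (·-nonPositive 1 δ≤0))
          (·-nonNegative 1 (·-nonNegative 2 0≤δ))))
      corner : ∀ v → InSquare K (block 1 1 0 0) (position v)
      corner v with covers v
      ... | (l , r) , b , t = (l , shrink r) , b , shrink t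

-- Tie events and the probability bound

open import Data.Nat using (_≤_; _*_; _^_)
open import Data.Rational using (_-_; _/_)

module _ {c ℓ₁ ℓ₂} (K : OrderedField c ℓ₁ ℓ₂) {n : ℕ} (G : RoadNetwork K n) {h : ℕ} (R : Grids G h) where
  open OrderedField K using (0#)
  open RoadNetwork G using (m; src; tgt)

  -- Ties at the target of the paths, and at their source in the reversed network.
  Event : Set c
  Event = ((Fin n × Square K) × Fin m × Fin m) ⊎ ((Fin n × Square K) × Fin m × Fin m)

  private Gᵒ = opposite K G (opposite-connected K G)

  Occurs : ∀ {τ} → Event → (Fin m → Fin τ) → Set _
  Occurs (inj₁ ((t , B) , e , f)) ρ = Tie K G B t ρ e f
  Occurs (inj₂ ((s , B) , e , f)) ρ = Tie K Gᵒ B s ρ e f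

  occurs? : ∀ {τ} E (ρ : Fin m → Fin τ) → Dec (Occurs E ρ)
  occurs? (inj₁ ((t , B) , e , f)) ρ = tie? K G B t ρ e f
  occurs? (inj₂ ((s , B) , e , f)) ρ = tie? K Gᵒ B s ρ e f

  targetEvents sourceEvents events : List Event
  targetEvents = map inj₁ (cartesianProduct (places K G R) (forks src))
  sourceEvents = map inj₂ (cartesianProduct (places K G R) (forks tgt))
  events = targetEvents ++ sourceEvents

  length-events : length events ≡ length (places K G R) * (length (forks src) ℕ.+ length (forks tgt))
  length-events = trans (length-++ targetEvents) (trans
    (cong₂ ℕ._+_ (size inj₁ (forks src)) (size inj₂ (forks tgt)))
    (sym (ℕₚ.*-distribˡ-+ (length (places K G R)) _ _)))
    where
    size : ∀ (f : _ → Event) xs → length (map f (cartesianProduct (places K G R) xs)) ≡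
      length (places K G R) * length xs
    size f xs = trans (length-map f (cartesianProduct (places K G R) xs))
      (length-cartesianProduct (places K G R) xs)

  events-determine : ∀ {τ} → All (λ E → ∃ λ e → Determines {τ = τ} e (Occurs E)) events
  events-determine {τ} = Allₚ.++⁺ {xs = targetEvents} (Allₚ.map⁺ at-target) (Allₚ.map⁺ at-source)
    where
    at-target : All (λ x → ∃ λ e → Determines {τ = τ} e (Occurs (inj₁ x)))
      (cartesianProduct (places K G R) (forks src))
    at-target = All.tabulate λ { {(t , B) , e , f} x∈ → e , λ ρ ρ′ →
      let (e≢f , same) = All.lookup (forks-distinct src)
            (proj₂ (∈-cartesianProduct⁻ (places K G R) (forks src) x∈)) in
      tie-determines-nuance K G B t ρ ρ′ e f e≢f same }
    at-source : All (λ x → ∃ λ e → Determines {τ = τ} e (Occurs (inj₂ x)))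
      (cartesianProduct (places K G R) (forks tgt))
    at-source = All.tabulate λ { {(s , B) , e , f} x∈ → e , λ ρ ρ′ →
      let (e≢f , same) = All.lookup (forks-distinct tgt)
            (proj₂ (∈-cartesianProduct⁻ (places K G R) (forks tgt) x∈)) in
      tie-determines-nuance K Gᵒ B s ρ ρ′ e f e≢f same }

  Ambiguous : ∀ {τ} → (Fin m → Fin τ) → Square K → Set _
  Ambiguous ρ B = ∃ λ s → ∃ λ t → ∃ λ P → ∃ λ Q → P ≢ Q ×
    LocalShortestPath G ρ B s t P × LocalShortestPath G ρ B s t Q × EquallyShort G ρ P Q

  ambiguity-occurs : ∀ {τ} (ρ : Fin m → Fin τ) {i} → i ≤ h → (B : Region G R i) →
    Ambiguous ρ (Region.area B) → ∃ λ E → E ∈ events × Occurs E ρ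
  ambiguity-occurs ρ i≤h B (s , t , P , Q , P≢Q , sp , sq , eq)
    with equally-short⇒tie-at-end K G (opposite-connected K G) ρ P Q P≢Q sp sq eq
  ... | inj₁ (t∈ , e , f , e≢f , same , tie) with ∈-forks src e≢f same
  ...   | inj₁ ef∈ = _ , ∈-++⁺ˡ (∈-map⁺ inj₁ (∈-cartesianProduct⁺ (∈-places K G R i≤h B t∈) ef∈)) , tie
  ...   | inj₂ fe∈ = _ , ∈-++⁺ˡ (∈-map⁺ inj₁ (∈-cartesianProduct⁺ (∈-places K G R i≤h B t∈) fe∈)) ,
    tie-sym K G (Region.area B) t ρ tie
  ambiguity-occurs ρ i≤h B (s , t , P , Q , P≢Q , sp , sq , eq)
      | inj₂ (s∈ , e , f , e≢f , same , tie) with ∈-forks tgt e≢f same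
  ...   | inj₁ ef∈ = _ , ∈-++⁺ʳ targetEvents (∈-map⁺ inj₂
    (∈-cartesianProduct⁺ (∈-places K G R i≤h B s∈) ef∈)) , tie
  ...   | inj₂ fe∈ = _ , ∈-++⁺ʳ targetEvents (∈-map⁺ inj₂
    (∈-cartesianProduct⁺ (∈-places K G R i≤h B s∈) fe∈)) , tie-sym K Gᵒ (Region.area B) s ρ tie

  unambiguous-bound : ∀ τ .{{_ : NonZero τ}} → ¬ OrderedField._≤_ K (Grids.δ R) 0# →
    32 * h * n ^ 3 * (maxDegree G C 2) ≤ τ →
    n * τ ^ m ≤ n * ∣ avoiding (occurs? {τ}) events ∣ ℕ.+ τ ^ m
  unambiguous-bound τ δ>0 32hn³C≤τ = ℕₚ.*-cancelʳ-≤ _ _ τ (begin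
    n * N * τ                     ≡⟨ ℕₚ.*-assoc n N τ ⟩
    n * (N * τ)                   ≤⟨ ℕₚ.*-monoʳ-≤ n (union-bound occurs? events events-determine) ⟩
    n * (s * τ ℕ.+ E * N)         ≡⟨ rearrange n s τ E N ⟩
    n * s * τ ℕ.+ E * n * N       ≤⟨ ℕₚ.+-monoʳ-≤ (n * s * τ) (ℕₚ.*-monoˡ-≤ N few-events) ⟩
    n * s * τ ℕ.+ τ * N           ≡⟨ collect (n * s) τ N ⟩
    (n * s ℕ.+ N) * τ             ∎)
    where
    open ℕₚ.≤-Reasoning
    N = τ ^ m
    s = ∣ avoiding (occurs? {τ}) events ∣
    E = length events
    Δ₂ = maxDegree G C 2
    rearrange : ∀ n s τ E N → n * (s * τ ℕ.+ E * N) ≡ n * s * τ ℕ.+ E * n * N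
    rearrange = solve-∀
    collect : ∀ a τ N → a * τ ℕ.+ τ * N ≡ (a ℕ.+ N) * τ
    collect = solve-∀
    reorder : ∀ n a c → n * a * (n * c) * n ≡ a * (n * (n * (n * 1))) * c
    reorder = solve-∀
    -- One factor `n` comes from the node in the region and one from the node of the fork. The third
    -- makes the number of events at most `τ / n`, hence the failure probability at most `1/n`.
    few-events : E * n ≤ τ
    few-events = begin
      E * n ≡⟨ cong (_* n) length-events ⟩
      length (places K G R) * (length (forks src) ℕ.+ length (forks tgt)) * n
        ≤⟨ ℕₚ.*-monoˡ-≤ n (ℕₚ.*-mono-≤ (length-places K G R δ>0) (length-forks K G)) ⟩
      n * (32 * h) * (n * Δ₂) * n  ≡⟨ reorder n (32 * h) Δ₂ ⟩
      32 * h * n ^ 3 * Δ₂          ≤⟨ 32hn³C≤τ ⟩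
      τ ∎

theorem2 : ∀ {c ℓ₁ ℓ₂} (K : OrderedField c ℓ₁ ℓ₂) →
    (n : ℕ) .{{_ : NonZero n}} (G : RoadNetwork K n) →
    (h : ℕ) (R : Grids G h) →
    (τ : ℕ) .{{_ : NonZero τ}} →
    32 * h * n ^ 3 * (maxDegree G C 2) ≤ τ →
    ProbabilityAtLeast (RoadNetwork.m G) τ (1ℚ - (+ 1) / n) (λ ρ →
      ∀ i → i ≤ h → (B : Region G R i) →
      ¬ (∃ λ s → ∃ λ t → ∃ λ P → ∃ λ Q →
           P ≢ Q ×
           LocalShortestPath G ρ (Region.area B) s t P ×
           LocalShortestPath G ρ (Region.area B) s t Q ×
           EquallyShort G ρ P Q))
-- A single node makes the tight square degenerate to a point, so regions cannot be counted with
-- positive cells. The required probability is 0 then, and the empty set of outcomes suffices.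
theorem2 K 1 G h R τ _ =
  ⊥ , (λ ω ω∈ → contradiction ω∈ ∉⊥) ,
  1-1/n≤ 1 (τ ^ m) {{ℕₚ.m^n≢0 τ m}} ∣ ⊥ {τ ^ m} ∣
    (ℕₚ.≤-trans (ℕₚ.≤-reflexive (ℕₚ.+-identityʳ (τ ^ m))) (ℕₚ.m≤n+m (τ ^ m) _))
  where open RoadNetwork G using (m)
theorem2 K n@(suc (suc _)) G h R τ 32hn³C≤τ =
  avoiding (occurs? K G R) (events K G R) ,
  (λ ω ω∈ i i≤h B ambiguous →
    let (E , E∈ , occurs) = ambiguity-occurs K G R (finToFun ω) i≤h B ambiguous in
    All.lookup (avoiding⇒¬ (occurs? K G R) (events K G R) ω∈) E∈ occurs) ,
  1-1/n≤ n (τ ^ m) {{ℕₚ.m^n≢0 τ m}} ∣ avoiding (occurs? K G R) (events K G R) ∣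
    (unambiguous-bound K G R τ (δ-positive K G R {zero} {suc zero} (λ ())) 32hn³C≤τ)
  where open RoadNetwork G using (m)
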